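{- For every integer $k>2$, as $n\to\infty$, \[n^{\frac{1}{k}n-o(n)}\leq H_n(C_{2k})\leq n^{\left(1-\frac{1}{3k} \right)n+o(n)}.\]
   Context: Two graphs on the same vertex set are called $G$-creating if the union of their edge sets contains $G$ as a (not necessarily induced) subgraph. $H_n(G)$ denotes the maximum number of Hamiltonian paths of the complete graph $K_n$ that are pairwise $G$-creating. $C_{2k}$ is the cycle of length $2k$. -}

module Defs where

open import Data.Nat using (ℕ; zero; suc; _≤_)
open import Data.Fin using (Fin; toℕ; fromℕ) renaming (zero to fzero)
open import Data.Product using (Σ; ∃; _×_; _,_)
open import Data.Sum using (_⊎_)
open import Data.List using (List; length)
open import Data.List.Relation.Unary.All using (All)
open import Data.List.Relation.Unary.AllPairs using (AllPairs)
open import Data.Empty using (⊥)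
open import Relation.Nullary using (¬_)
open import Relation.Binary.PropositionalEquality using (_≡_)
open import Function.Definitions using (Injective)
open import Function.Bundles using (_⇔_)

EdgeSet : ℕ → Set₁
EdgeSet n = Fin n → Fin n → Set

-- A Hamiltonian path of K_n is given by a vertex ordering v : Fin n → Fin n
-- that is injective (hence a bijection).  Its edges are the pairs of
-- consecutive vertices {v i, v (i+1)}.
IsHamSeq : (n : ℕ) → (Fin n → Fin n) → Set
IsHamSeq n v = Injective _≡_ _≡_ v

PathEdges : {n : ℕ} → (Fin n → Fin n) → EdgeSet n
PathEdges {n} v x y =
  Σ (Fin n) λ i → Σ (Fin n) λ j → (toℕ j ≡ suc (toℕ i)) ×
    ((v i ≡ x × v j ≡ y) ⊎ (v i ≡ y × v j ≡ x))

SamePath : {n : ℕ} → (Fin n → Fin n) → (Fin n → Fin n) → Set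
SamePath {n} v w = (x y : Fin n) → PathEdges v x y ⇔ PathEdges w x y

_∪E_ : {n : ℕ} → EdgeSet n → EdgeSet n → EdgeSet n
(E ∪E F) x y = E x y ⊎ F x y

-- E contains the cycle C_m (m ≥ 3 intended) as a (not necessarily induced)
-- subgraph: injective c : Fin m → Fin n with c i ~ c (i+1) and c (m-1) ~ c 0.
ContainsCycle : {n : ℕ} → ℕ → EdgeSet n → Set
ContainsCycle zero E = ⊥
ContainsCycle {n} (suc r) E =
  Σ (Fin (suc r) → Fin n) λ c → Injective _≡_ _≡_ c ×
    (((i j : Fin (suc r)) → toℕ j ≡ suc (toℕ i) → E (c i) (c j)) ×
     E (c (fromℕ r)) (c fzero))

Creating : {n : ℕ} → ℕ → (Fin n → Fin n) → (Fin n → Fin n) → Set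
Creating m v w = ContainsCycle m (PathEdges v ∪E PathEdges w)

record CreatingFamily (n m : ℕ) : Set where
  field
    paths    : List (Fin n → Fin n)
    ham      : All (IsHamSeq n) paths
    distinct : AllPairs (λ v w → ¬ SamePath v w) paths
    creating : AllPairs (Creating m) paths

IsH : ℕ → ℕ → ℕ → Set
IsH n m h =
  (Σ (CreatingFamily n m) λ F → length (CreatingFamily.paths F) ≡ h) ×
  ((F : CreatingFamily n m) → length (CreatingFamily.paths F) ≤ h)

{-# OPTIONS --safe #-}
module Submission where

-- Lower bound.  Fix q separators a₀, a₁, … and q blocks of k - 1 vertices, and visit a₀ X₀ a₁ X₁ … for every
-- order X of the blocks.  If two orders differ at i, then aᵢ, Xᵢ, aᵢ₊₁ and the other i-th block form a C_2k,
-- so there are (n/k)! = n^(n/k - o(n)) pairwise creating paths.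
--
-- Upper bound.  Suppose p orderings of the vertices are coloured with C colours so that orderings of equal
-- colour lie in a common C_2k-free graph.  A permutation carrying a path v of the family to an ordering w
-- determines, together with the colour of w, both v and w; hence h p ≤ n^n C.
--
-- Such orderings are grown as linear forests.  In each of T layers, some piece ends S are joined to piece
-- starts R by a greedily built graph with out-degree 2d and in-degree at most d that never closes a C_2k;
-- this works while d^(2k-1) is small compared with |R|, in particular for d = n^(1/3k).  Then c edges of a
-- matching are chosen one by one, by double counting always with d options.  The colour records S and R
-- in each layer (3^n possibilities) and the ends of the final o(n) pieces.  The pieces are glued along
-- chains of fresh vertices that are too long to lie on a C_2k.  This gives p = d^(Tc) = n^(n/3k - o(n))
-- orderings with only n^(o(n)) colours.

open import Defs
open import Algebra.Properties.CommutativeSemigroup using (interchange)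
open import Data.Empty using (⊥; ⊥-elim)
open import Data.Fin using (Fin; toℕ; fromℕ; fromℕ<; cast; combine; remQuot; funToFin; finToFun; punchOut; _≟_) renaming (zero to fzero; suc to fsuc)
open import Data.Fin.Properties using (toℕ-injective; toℕ-fromℕ<; toℕ-fromℕ; toℕ-cast; fromℕ<-injective; fromℕ<-cong; combine-injective; combine-remQuot; finToFun-funToFin; injective⇒≤; punchOut-injective) renaming (any? to anyFin?)
open import Data.List using (List; []; _∷_; [_]; _++_; length; lookup; map; filter; concatMap; concat; reverse; take; drop; allFin)
open import Data.List.Properties using (length-++; length-map; length-reverse; unfold-reverse; length-take; length-drop; take++drop≡id; length-tabulate; ++-assoc; ++-identityʳ; concat-++; map-++; filter-accept; filter-reject; filter-all; filter-none; filter-++)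
open import Data.List.Membership.Propositional using (_∈_; _∉_; find; lose)
open import Data.List.Membership.Propositional.Properties
open import Data.List.Relation.Binary.Permutation.Propositional as Perm using (_↭_; ↭-refl; ↭-sym; ↭-trans; ↭-prep; ↭-swap; ↭-reflexive; module PermutationReasoning)
open import Data.List.Relation.Binary.Permutation.Propositional.Properties as Permₚ using (All-resp-↭; Any-resp-↭; ∈-resp-↭; ↭-length; shift; shifts; ↭-reverse)
open import Data.List.Relation.Unary.All as All using (All; []; _∷_)
import Data.List.Relation.Unary.All.Properties as Allₚ
open import Data.List.Relation.Unary.AllPairs as AllPairs using (AllPairs; []; _∷_)
import Data.List.Relation.Unary.AllPairs.Properties as AllPairsₚ
open import Data.List.Relation.Unary.Any using (Any; here; there; any?)
open import Data.List.Relation.Unary.Any.Properties using (reverse⁻)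
open import Data.List.Relation.Unary.Unique.Propositional using (Unique)
import Data.List.Relation.Unary.Unique.Propositional.Properties as Uniqueₚ
open import Data.Nat using (ℕ; zero; suc; pred; _+_; _*_; _∸_; _^_; _!; _≤_; _<_; _≤?_; _<?_; z≤n; s≤s; s≤s⁻¹; NonZero; >-nonZero)
open import Data.Nat.DivMod using (_/_; _%_; m≡m%n+[m/n]*n; m%n<n; m/n*n≤m; m<n⇒m%n≡m; n%n≡0; %-distribˡ-+; [m+n]%n≡m%n)
open import Data.Nat.ListAction using (sum)
open import Data.Nat.Properties hiding (_≟_)
open import Data.Nat.Tactic.RingSolver using (solve-∀)
open import Data.Product using (Σ; ∃; _×_; _,_; proj₁; proj₂; uncurry)
open import Data.Sum as Sum using (_⊎_; inj₁; inj₂; [_,_]′; swap)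
open import Data.Vec using (Vec; []; _∷_; toList; fromList)
open import Data.Vec.Properties using (toList∘fromList)
open import Function using (_∘_; id)
open import Function.Bundles using (Equivalence)
open import Function.Definitions using (Injective)
open import Level using (0ℓ)
open import Relation.Binary.PropositionalEquality using (_≡_; _≢_; refl; sym; trans; cong; cong₂; subst; subst₂; module ≡-Reasoning)
open import Relation.Nullary using (¬_; Dec; yes; no; contradiction)
open import Relation.Nullary.Decidable using (_×-dec_; ¬?)
open import Relation.Unary using (Pred; Decidable)

-- All orderings of one colour must share one graph, yet colours must stay few. Listing the edges of
-- that graph would cost more than is gained, so the greedy construction is a deterministic function
-- of the two sets S and R, and the graph is rebuilt from the labels. The freedom lies only in the
-- matching: a source has 2d edges because some of them lead to used targets, and while fewer than c
-- of the 2c sources are matched, double counting leaves some source with d good edges.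
--
-- One layer yields c edges with c a small constant fraction of n, so T layers are needed for Tc to
-- come close to n. T depends only on the accuracy a/b; hence degrees stay O(d) and the labels,
-- 3^(nT) in number, cost n^(o(n)).
--
-- The size of d is limited from above: about d^(2k-1) vertices are reached by walks of length 2k-1
-- and are forbidden as targets, and this must stay below c. Walks are excluded rather than paths
-- because they are counted by degrees alone.

private variable
  n : ℕ

-- Graphs as lists of directed edges, walks and cycles

Graph : ℕ → Set
Graph n = List (Fin n × Fin n)

Edge : Graph n → EdgeSet n
Edge E x y = (x , y) ∈ E ⊎ (y , x) ∈ E

outEdges inEdges : Graph n → Fin n → Graph n
outEdges E x = filter (λ e → proj₁ e ≟ x) E
inEdges E x = filter (λ e → proj₂ e ≟ x) E

outdeg indeg : Graph n → Fin n → ℕ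
outdeg E x = length (outEdges E x)
indeg E x = length (inEdges E x)

nbrs : Graph n → Fin n → List (Fin n)
nbrs E x = map proj₂ (outEdges E x) ++ map proj₁ (inEdges E x)

nbrs⁺ : ∀ {E : Graph n} {x y} → Edge E x y → y ∈ nbrs E x
nbrs⁺ {E = E} {x} (inj₁ e) = ∈-++⁺ˡ (∈-map⁺ proj₂ (∈-filter⁺ (λ e → proj₁ e ≟ x) e refl))
nbrs⁺ {E = E} {x} (inj₂ e) = ∈-++⁺ʳ (map proj₂ (outEdges E x)) (∈-map⁺ proj₁ (∈-filter⁺ (λ e → proj₂ e ≟ x) e refl))

nbrs⁻ : ∀ {E : Graph n} {x y} → y ∈ nbrs E x → Edge E x y
nbrs⁻ {E = E} {x} y∈ with ∈-++⁻ (map proj₂ (outEdges E x)) y∈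
... | inj₁ p with ∈-map⁻ proj₂ p
...   | _ , q , refl with ∈-filter⁻ (λ e → proj₁ e ≟ x) {xs = E} q
...     | r , refl = inj₁ r
nbrs⁻ {E = E} {x} y∈ | inj₂ p with ∈-map⁻ proj₁ p
...   | _ , q , refl with ∈-filter⁻ (λ e → proj₂ e ≟ x) {xs = E} q
...     | r , refl = inj₂ r

length-nbrs : (E : Graph n) (x : Fin n) → length (nbrs E x) ≡ outdeg E x + indeg E x
length-nbrs E x = trans (length-++ (map proj₂ (outEdges E x)))
  (cong₂ _+_ (length-map proj₂ (outEdges E x)) (length-map proj₁ (inEdges E x)))

-- Endpoints are repeated once per walk, so the length of the list is bounded by a plain power of
-- the degree. Walks may revisit vertices; forbidding their endpoints only makes the greedy
-- condition stronger.
reach : Graph n → ℕ → Fin n → List (Fin n)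
reach E zero x = [ x ]
reach E (suc ℓ) x = concatMap (nbrs E) (reach E ℓ x)

reach-snoc : ∀ {E : Graph n} ℓ {x y z} → y ∈ reach E ℓ x → Edge E y z → z ∈ reach E (suc ℓ) x
reach-snoc {E = E} ℓ y∈ e = ∈-concatMap⁺ (nbrs E) (lose y∈ (nbrs⁺ e))

reach-unsnoc : ∀ {E : Graph n} ℓ {x z} → z ∈ reach E (suc ℓ) x → ∃ λ y → y ∈ reach E ℓ x × Edge E y z
reach-unsnoc {E = E} ℓ {x} z∈ with find (∈-concatMap⁻ (nbrs E) {xs = reach E ℓ x} z∈)
... | y , y∈ , z∈' = y , y∈ , nbrs⁻ z∈'

length-concatMap-≤ : ∀ {A B : Set} (f : A → List B) Δ → (∀ y → length (f y) ≤ Δ) → ∀ xs →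
  length (concatMap f xs) ≤ length xs * Δ
length-concatMap-≤ f Δ f≤ [] = z≤n
length-concatMap-≤ f Δ f≤ (x ∷ xs) = subst (_≤ Δ + length xs * Δ) (sym (length-++ (f x)))
  (+-mono-≤ (f≤ x) (length-concatMap-≤ f Δ f≤ xs))

length-reach-≤ : ∀ {E : Graph n} {Δ} → (∀ y → length (nbrs E y) ≤ Δ) → ∀ ℓ x → length (reach E ℓ x) ≤ Δ ^ ℓ
length-reach-≤ deg zero x = ≤-refl
length-reach-≤ {E = E} {Δ} deg (suc ℓ) x = ≤-trans (length-concatMap-≤ (nbrs E) Δ deg (reach E ℓ x))
  (≤-trans (*-monoˡ-≤ Δ (length-reach-≤ deg ℓ x)) (≤-reflexive (*-comm (Δ ^ ℓ) Δ)))

-- The edge of a cycle of length m + 1 that was added last would have closed a walk of length m.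
data Good (m : ℕ) {n : ℕ} : Graph n → Set where
  []  : Good m []
  add : ∀ {E x y} → y ∉ reach E m x → Good m E → Good m ((x , y) ∷ E)

-- Working with periodic sequences avoids rotating a cycle so that a given edge comes last.
record Unrolled (M : ℕ) (E : EdgeSet n) : Set where
  field
    at       : ℕ → Fin n
    periodic : ∀ i → at (M + i) ≡ at i
    apart    : ∀ i e → 0 < e → e < M → at (e + i) ≢ at i
    edge     : ∀ i → E (at i) (at (suc i))

suc-% : ∀ i r → suc i % suc (suc r) ≡ suc (i % suc (suc r)) % suc (suc r)
suc-% i r = trans (%-distribˡ-+ 1 i (suc (suc r)))
  (cong (λ z → (z + i % suc (suc r)) % suc (suc r)) (m<n⇒m%n≡m {n = suc (suc r)} {m = 1} (s≤s (s≤s z≤n))))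

-- With `ρ` the residue of `i`, the sum `e + ρ` either stays below `M` and exceeds `ρ`, or wraps
-- around once to a value below `ρ`.
%-apart : ∀ i e r → 0 < e → e < suc r → (e + i) % suc r ≢ i % suc r
%-apart i e r 0<e e<M eq = case (suc r ≤? e + ρ)
  where
  M = suc r
  ρ = i % M
  eq′ : (e + ρ) % M ≡ ρ
  eq′ = trans (cong (λ z → (z + ρ) % M) (sym (m<n⇒m%n≡m e<M))) (trans (sym (%-distribˡ-+ e i M)) eq)
  case : Dec (M ≤ e + ρ) → ⊥
  case (no ¬p) = <⇒≢ (m<n+m ρ 0<e) (trans (sym eq′) (m<n⇒m%n≡m (≰⇒> ¬p)))
  case (yes p) = <⇒≢ f<ρ (trans (sym (trans ([m+n]%n≡m%n f M) (m<n⇒m%n≡m (<-trans f<ρ (m%n<n i M)))))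
                               (trans (cong (_% M) (m∸n+n≡m p)) eq′))
    where
    f = (e + ρ) ∸ M
    f<ρ : f < ρ
    f<ρ = +-cancelʳ-< M f ρ (subst (_< ρ + M) (sym (m∸n+n≡m p)) (subst (_< ρ + M) (+-comm ρ e) (+-monoʳ-< ρ e<M)))

unroll : ∀ {E : EdgeSet n} r → ContainsCycle (suc (suc r)) E → Unrolled (suc (suc r)) E
unroll {n} {E} r (c , c-inj , c-edge , c-close) = record
  { at = at
  ; periodic = λ i → at-cong (M + i) i (trans (cong (_% M) (+-comm M i)) ([m+n]%n≡m%n i M))
  ; apart = λ i e 0<e e<M eq → %-apart i e (suc r) 0<e e<M (fromℕ<-injective _ _ (m%n<n (e + i) M) (m%n<n i M) (c-inj eq))
  ; edge = edge
  }
  where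
  M = suc (suc r)
  ix : ℕ → Fin M
  ix i = fromℕ< (m%n<n i M)
  at : ℕ → Fin n
  at i = c (ix i)
  toℕ-ix : ∀ i → toℕ (ix i) ≡ i % M
  toℕ-ix i = toℕ-fromℕ< (m%n<n i M)
  at-cong : ∀ i j → i % M ≡ j % M → at i ≡ at j
  at-cong i j eq = cong c (fromℕ<-cong _ _ eq (m%n<n i M) (m%n<n j M))
  edge : ∀ i → E (at i) (at (suc i))
  edge i with suc (i % M) ≤? suc r
  ... | yes p = c-edge (ix i) (ix (suc i)) (trans (toℕ-ix (suc i)) (trans (trans (suc-% i r) (m<n⇒m%n≡m (s≤s p))) (cong suc (sym (toℕ-ix i)))))
  ... | no ¬p = subst₂ (λ a b → E (c a) (c b)) (toℕ-injective eq₁) (toℕ-injective eq₂) c-close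
    where
    last≡ : i % M ≡ suc r
    last≡ = ≤-antisym (s≤s⁻¹ (m%n<n i M)) (s≤s⁻¹ (≰⇒> ¬p))
    eq₁ : toℕ (fromℕ (suc r)) ≡ toℕ (ix i)
    eq₁ = trans (toℕ-fromℕ (suc r)) (sym (trans (toℕ-ix i) last≡))
    eq₂ : 0 ≡ toℕ (ix (suc i))
    eq₂ = sym (trans (toℕ-ix (suc i)) (trans (suc-% i r) (trans (cong (λ z → suc z % M) last≡) (n%n≡0 M))))

-- A step along the new edge would be the only such step in its period. The other `m` steps would
-- then form a walk in `E` between the ends of that edge, contrary to the condition on `y`.
drop-edge : ∀ {m} {E : Graph n} {x y} → 2 ≤ m → y ∉ reach E m x →
  Unrolled (suc m) (Edge ((x , y) ∷ E)) → Unrolled (suc m) (Edge E)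
drop-edge {n} {m} {E} {x} {y} 2≤m y∉ U = record { at = at ; periodic = periodic ; apart = apart ; edge = edge′ }
  where
  open Unrolled U
  New : Fin n → Fin n → Set
  New u v = (u ≡ x × v ≡ y) ⊎ (u ≡ y × v ≡ x)
  split : ∀ {u v} → Edge ((x , y) ∷ E) u v → New u v ⊎ Edge E u v
  split (inj₁ (here refl)) = inj₁ (inj₁ (refl , refl))
  split (inj₁ (there p)) = inj₂ (inj₁ p)
  split (inj₂ (here refl)) = inj₁ (inj₂ (refl , refl))
  split (inj₂ (there p)) = inj₂ (inj₂ p)
  module _ (i : ℕ) (new : New (at i) (at (suc i))) where
    other : ∀ e → 0 < e → e < suc m → ¬ New (at (e + i)) (at (suc (e + i)))
    other e 0<e e<M new′ = go (same new new′)
      where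
      same : ∀ {u v u′ v′} → New u v → New u′ v′ → (u′ ≡ u) ⊎ (u′ ≡ v × v′ ≡ u)
      same (inj₁ (refl , refl)) (inj₁ (refl , refl)) = inj₁ refl
      same (inj₁ (refl , refl)) (inj₂ (refl , refl)) = inj₂ (refl , refl)
      same (inj₂ (refl , refl)) (inj₁ (refl , refl)) = inj₂ (refl , refl)
      same (inj₂ (refl , refl)) (inj₂ (refl , refl)) = inj₁ refl
      -- The edge can recur in the opposite direction only at the very next step, which would give
      -- `at (2 + i)` equal to `at i`; `2 ≤ m` makes the period at least 3 and rules this out.
      flipped : ∀ e → e < suc m → at (e + i) ≡ at (suc i) → at (suc (e + i)) ≡ at i → 0 < e → ⊥
      flipped (suc zero) _ _ q _ = apart i 2 (s≤s z≤n) (s≤s 2≤m) q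
      flipped (suc (suc e)) e<M p _ _ = apart (suc i) (suc e) (s≤s z≤n) (<-trans (n<1+n _) e<M)
        (trans (cong at (+-suc (suc e) i)) p)
      go : (at (e + i) ≡ at i) ⊎ (at (e + i) ≡ at (suc i) × at (suc (e + i)) ≡ at i) → ⊥
      go (inj₁ eq) = apart i e 0<e e<M eq
      go (inj₂ (p , q)) = flipped e e<M p q 0<e
    old : ∀ e → e < m → Edge E (at (e + suc i)) (at (suc (e + suc i)))
    old e e<m = [ ⊥-elim ∘ other (suc e) (s≤s z≤n) (s≤s e<m) ∘ subst (λ j → New (at j) (at (suc j))) (+-suc e i) , (λ p → p) ]′
      (split (edge (e + suc i)))
    forward : ∀ e → e ≤ m → at (e + suc i) ∈ reach E e (at (suc i))
    forward zero _ = here refl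
    forward (suc e) e<m = reach-snoc e (forward e (<⇒≤ e<m)) (old e e<m)
    around : at (m + suc i) ≡ at i
    around = trans (cong at (+-suc m i)) (periodic i)
    backward : ∀ e f → e + f ≡ m → at (f + suc i) ∈ reach E e (at i)
    backward zero f refl = here around
    backward (suc e) f refl = reach-snoc e (backward e (suc f) (+-suc e f)) (swap (old f (s≤s (m≤n+m f e))))
    -- The remaining walk is read backwards if `at i` is `x`, and forwards if `at i` is `y`.
    closed : y ∈ reach E m x
    closed = [ (λ { (p , q) → subst₂ (λ u v → v ∈ reach E m u) p q (backward m 0 (+-identityʳ m)) })
             , (λ { (p , q) → subst₂ (λ u v → v ∈ reach E m u) q p (subst (_∈ reach E m (at (suc i))) around (forward m ≤-refl)) }) ]′ new
  edge′ : ∀ i → Edge E (at i) (at (suc i))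
  edge′ i = [ (λ new → contradiction (closed i new) y∉) , (λ p → p) ]′ (split (edge i))

-- No cycle passes through the newest edge, so a cycle would survive the deletion of all edges in
-- reverse order, down to the empty graph.
Good⇒¬Cycle : ∀ {m} {E : Graph n} → 2 ≤ m → Good m E → ¬ ContainsCycle (suc m) (Edge E)
Good⇒¬Cycle {m = suc r} 2≤m good = go good ∘ unroll r
  where
  go : ∀ {E} → Good (suc r) E → ¬ Unrolled (suc (suc r)) (Edge E)
  go [] U with Unrolled.edge U 0
  ... | inj₁ ()
  ... | inj₂ ()
  go (add y∉ g) U = go g (drop-edge 2≤m y∉ U)

-- Such a potential bounds walk lengths from below, so it certifies without listing walks that no
-- short walk leads from the far end of a glue chain back to the old graph.
Lipschitz : (Fin n → ℕ) → Graph n → Set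
Lipschitz f = All (λ e → f (proj₁ e) ≤ suc (f (proj₂ e)) × f (proj₂ e) ≤ suc (f (proj₁ e)))

reach-potential : ∀ {E : Graph n} {f} → Lipschitz f E → ∀ ℓ {x y} → y ∈ reach E ℓ x → f x ≤ ℓ + f y
reach-potential lip zero (here refl) = ≤-refl
reach-potential {f = f} lip (suc ℓ) {x} {z} z∈ with reach-unsnoc ℓ z∈
... | y , y∈ , e = ≤-trans (reach-potential lip ℓ y∈) (≤-trans (+-monoʳ-≤ ℓ (step e)) (≤-reflexive (+-suc ℓ (f z))))
  where
  step : Edge _ y z → f y ≤ suc (f z)
  step (inj₁ p) = proj₁ (All.lookup lip p)
  step (inj₂ p) = proj₂ (All.lookup lip p)

Isolated : Graph n → Fin n → Set
Isolated E g = All (λ e → proj₁ e ≢ g × proj₂ e ≢ g) E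

isolated∉reach : ∀ {E : Graph n} {g} → Isolated E g → ∀ ℓ {x} → g ∉ reach E (suc ℓ) x
isolated∉reach iso ℓ g∈ with reach-unsnoc ℓ g∈
... | _ , _ , inj₁ p = proj₂ (All.lookup iso p) refl
... | _ , _ , inj₂ p = proj₁ (All.lookup iso p) refl

-- Orderings as lists, paths, cycles and chains of fresh vertices

data Adj {A : Set} (x y : A) : List A → Set where
  here  : ∀ {zs} → Adj x y (x ∷ y ∷ zs)
  there : ∀ {z zs} → Adj x y zs → Adj x y (z ∷ zs)

Adj-++ˡ : ∀ {A : Set} {x y : A} {xs} ys → Adj x y xs → Adj x y (xs ++ ys)
Adj-++ˡ ys here = here
Adj-++ˡ ys (there a) = there (Adj-++ˡ ys a)

Adj-++ʳ : ∀ {A : Set} {x y : A} xs {ys} → Adj x y ys → Adj x y (xs ++ ys)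
Adj-++ʳ [] a = a
Adj-++ʳ (x ∷ xs) a = there (Adj-++ʳ xs a)

Adj-∈ˡ : ∀ {A : Set} {x y : A} {xs} → Adj x y xs → x ∈ xs
Adj-∈ˡ here = here refl
Adj-∈ˡ (there a) = there (Adj-∈ˡ a)

Adj-functional : ∀ {A : Set} {x y y′ : A} {xs} → Unique xs → Adj x y xs → Adj x y′ xs → y ≡ y′
Adj-functional u here here = refl
Adj-functional (p ∷ _) here (there b) = contradiction refl (All.lookup p (Adj-∈ˡ b))
Adj-functional (p ∷ _) (there a) here = contradiction refl (All.lookup p (Adj-∈ˡ a))
Adj-functional (_ ∷ u) (there a) (there b) = Adj-functional u a b

Adj-lookup : ∀ {A : Set} (xs : List A) (i j : Fin (length xs)) → toℕ j ≡ suc (toℕ i) →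
  Adj (lookup xs i) (lookup xs j) xs
Adj-lookup (x ∷ y ∷ xs) fzero (fsuc fzero) _ = here
Adj-lookup (x ∷ xs) (fsuc i) (fsuc j) eq = there (Adj-lookup xs i j (cong pred eq))

lookup-Adj : ∀ {A : Set} {x y : A} {xs} → Adj x y xs →
  ∃ λ i → ∃ λ j → toℕ j ≡ suc (toℕ i) × lookup xs i ≡ x × lookup xs j ≡ y
lookup-Adj here = fzero , fsuc fzero , refl , refl , refl
lookup-Adj (there a) with lookup-Adj a
... | i , j , eq , p , q = fsuc i , fsuc j , cong suc eq , p , q

lookup-injective : ∀ {A : Set} {xs : List A} → Unique xs → ∀ i j → lookup xs i ≡ lookup xs j → i ≡ j
lookup-injective (p ∷ u) fzero fzero eq = refl
lookup-injective {xs = x ∷ xs} (p ∷ u) fzero (fsuc j) eq = contradiction eq (All.lookup p (∈-lookup j))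
lookup-injective {xs = x ∷ xs} (p ∷ u) (fsuc i) fzero eq = contradiction (sym eq) (All.lookup p (∈-lookup i))
lookup-injective (p ∷ u) (fsuc i) (fsuc j) eq = cong fsuc (lookup-injective u i j eq)

nth : ∀ {A : Set} {m} (xs : List A) → length xs ≡ m → Fin m → A
nth xs eq i = lookup xs (cast (sym eq) i)

nth-injective : ∀ {A : Set} {m} {xs : List A} (eq : length xs ≡ m) → Unique xs → Injective _≡_ _≡_ (nth xs eq)
nth-injective refl u {i} {j} p = toℕ-injective
  (trans (sym (toℕ-cast refl i)) (trans (cong toℕ (lookup-injective u _ _ p)) (toℕ-cast refl j)))

nth-Adj : ∀ {A : Set} {m} (xs : List A) (eq : length xs ≡ m) i j → toℕ j ≡ suc (toℕ i) → Adj (nth xs eq i) (nth xs eq j) xs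
nth-Adj xs eq i j p = Adj-lookup xs _ _ (trans (toℕ-cast (sym eq) j) (trans p (cong suc (sym (toℕ-cast (sym eq) i)))))

Adj-nth : ∀ {A : Set} {m} {xs : List A} (eq : length xs ≡ m) {x y} → Adj x y xs →
  ∃ λ i → ∃ λ j → toℕ j ≡ suc (toℕ i) × nth xs eq i ≡ x × nth xs eq j ≡ y
Adj-nth {xs = xs} refl a with lookup-Adj a
... | i , j , p , q , r = i , j , p , trans (cong (lookup xs) (toℕ-injective (toℕ-cast refl i))) q ,
                          trans (cong (lookup xs) (toℕ-injective (toℕ-cast refl j))) r

Adj⇒PathEdges : ∀ {xs : List (Fin n)} (eq : length xs ≡ n) {x y} → Adj x y xs → PathEdges (nth xs eq) x y
Adj⇒PathEdges eq a with Adj-nth eq a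
... | i , j , p , q , r = i , j , p , inj₁ (q , r)

PathEdges⇒Adj : ∀ {xs : List (Fin n)} (eq : length xs ≡ n) {x y} → PathEdges (nth xs eq) x y → Adj x y xs ⊎ Adj y x xs
PathEdges⇒Adj {xs = xs} eq (i , j , p , inj₁ (refl , refl)) = inj₁ (nth-Adj xs eq i j p)
PathEdges⇒Adj {xs = xs} eq (i , j , p , inj₂ (refl , refl)) = inj₂ (nth-Adj xs eq i j p)

PathEdges-sym : {v : Fin n → Fin n} {x y : Fin n} → PathEdges v x y → PathEdges v y x
PathEdges-sym (i , j , p , q) = i , j , p , swap q

data Path {n} (E : EdgeSet n) : Fin n → List (Fin n) → Fin n → Set where
  ⟨_⟩ : ∀ x → Path E x (x ∷ []) x
  _∷_ : ∀ {x y ys z} → E x y → Path E y ys z → Path E x (x ∷ ys) z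

Path-map : ∀ {E F : EdgeSet n} → (∀ {x y} → E x y → F x y) → ∀ {s xs e} → Path E s xs e → Path F s xs e
Path-map f ⟨ x ⟩ = ⟨ x ⟩
Path-map f (e ∷ p) = f e ∷ Path-map f p

Path-++ : ∀ {E : EdgeSet n} {s xs e s′ xs′ e′} → Path E s xs e → E e s′ → Path E s′ xs′ e′ → Path E s (xs ++ xs′) e′
Path-++ ⟨ x ⟩ a q = a ∷ q
Path-++ (b ∷ p) a q = b ∷ Path-++ p a q

Path-Adj : ∀ {E : EdgeSet n} {s xs e} → Path E s xs e → ∀ {x y} → Adj x y xs → E x y
Path-Adj (e ∷ ⟨ _ ⟩) here = e
Path-Adj (e ∷ (_ ∷ _)) here = e
Path-Adj (e ∷ p) (there a) = Path-Adj p a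

Adj-join : ∀ {E : EdgeSet n} {s xs e s′ xs′ e′} → Path E s xs e → Path E s′ xs′ e′ → Adj e s′ (xs ++ xs′)
Adj-join ⟨ _ ⟩ ⟨ _ ⟩ = here
Adj-join ⟨ _ ⟩ (_ ∷ _) = here
Adj-join (_ ∷ p) q = there (Adj-join p q)

Path-start∈ : ∀ {E : EdgeSet n} {s xs e} → Path E s xs e → s ∈ xs
Path-start∈ ⟨ _ ⟩ = here refl
Path-start∈ (_ ∷ _) = here refl

Path-end∈ : ∀ {E : EdgeSet n} {s xs e} → Path E s xs e → e ∈ xs
Path-end∈ ⟨ _ ⟩ = here refl
Path-end∈ (_ ∷ p) = there (Path-end∈ p)

Path-snoc : ∀ {E : EdgeSet n} {s xs e} → Path E s xs e → ∀ {y} → E e y → Path E s (xs ++ [ y ]) y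
Path-snoc p e = Path-++ p e ⟨ _ ⟩

Path-last : ∀ {E : EdgeSet n} {s xs e} → Path E s xs e → ∀ i → suc (toℕ i) ≡ length xs → lookup xs i ≡ e
Path-last ⟨ _ ⟩ fzero _ = refl
Path-last (_ ∷ ⟨ _ ⟩) fzero ()
Path-last (_ ∷ (_ ∷ _)) fzero ()
Path-last (_ ∷ p) (fsuc i) eq = Path-last p i (cong pred eq)

cycle : ∀ {E : EdgeSet n} {r s xs e} → Path E s xs e → Unique xs → length xs ≡ suc r → E e s → ContainsCycle (suc r) E
cycle {E = E} {r} {s} {xs} {e} p u eq close = nth xs eq , nth-injective eq u ,
  (λ i j a → Path-Adj p (nth-Adj xs eq i j a)) ,
  subst₂ E (sym (Path-last p (cast (sym eq) (fromℕ r)) (trans (cong suc (trans (toℕ-cast (sym eq) (fromℕ r)) (toℕ-fromℕ r))) (sym eq))))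
           (sym (first p eq)) close
  where
  first : ∀ {s xs e} → Path E s xs e → (eq : length xs ≡ suc r) → nth xs eq fzero ≡ s
  first ⟨ _ ⟩ _ = refl
  first (_ ∷ _) _ = refl

ContainsCycle-map : ∀ m {E F : EdgeSet n} → (∀ x y → E x y → F x y) → ContainsCycle m E → ContainsCycle m F
ContainsCycle-map (suc r) f (c , inj , e , z) = c , inj , (λ i j p → f _ _ (e i j p)) , f _ _ z

finish : ∀ {A : Set} → A → List A → A
finish u [] = u
finish u (g ∷ gs) = finish g gs

chain : Graph n → Fin n → List (Fin n) → Graph n
chain E u [] = E
chain E u (g ∷ gs) = chain ((u , g) ∷ E) g gs

chain-⊆ : ∀ {E : Graph n} u gs {e} → e ∈ E → e ∈ chain E u gs
chain-⊆ u [] p = p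
chain-⊆ u (g ∷ gs) p = chain-⊆ g gs (there p)

chain-path : ∀ {E : Graph n} u gs → Path (Edge (chain E u gs)) u (u ∷ gs) (finish u gs)
chain-path u [] = ⟨ u ⟩
chain-path u (g ∷ gs) = inj₁ (chain-⊆ g gs (here refl)) ∷ chain-path g gs

isolated-∷ : ∀ {E : Graph n} {u g : Fin n} {hs} → All (u ≢_) hs → All (g ≢_) hs → All (Isolated E) hs → All (Isolated ((u , g) ∷ E)) hs
isolated-∷ [] [] [] = []
isolated-∷ (p ∷ ps) (q ∷ qs) (i ∷ is) = ((p , q) ∷ i) ∷ isolated-∷ ps qs is

chain-isolated : ∀ {E : Graph n} u gs {h} → h ∉ u ∷ gs → Isolated E h → Isolated (chain E u gs) h
chain-isolated u [] h∉ i = i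
chain-isolated u (g ∷ gs) h∉ i = chain-isolated g gs (h∉ ∘ there)
  (((λ { refl → h∉ (here refl) }) , (λ { refl → h∉ (there (here refl)) })) ∷ i)

-- Each new edge ends in a vertex that is still isolated, and no walk of positive length arrives
-- there.
chain-good : ∀ {m} {E : Graph n} u gs → Unique (u ∷ gs) → All (Isolated E) gs → Good (suc m) E → Good (suc m) (chain E u gs)
chain-good u [] _ _ good = good
chain-good {m = m} u (g ∷ gs) ((u≢g ∷ u≢) ∷ (g≢ ∷ uniq)) (i ∷ is) good =
  chain-good g gs (g≢ ∷ uniq) (isolated-∷ u≢ g≢ is) (add (isolated∉reach i m) good)

update : Fin n → ℕ → (Fin n → ℕ) → Fin n → ℕ
update g c f v with v ≟ g
... | yes _ = c
... | no _ = f v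

update-at : ∀ (g : Fin n) c f → update g c f g ≡ c
update-at g c f with g ≟ g
... | yes _ = refl
... | no ¬p = contradiction refl ¬p

update-other : ∀ {g : Fin n} {c f v} → v ≢ g → update g c f v ≡ f v
update-other {g = g} {v = v} v≢g with v ≟ g
... | yes p = contradiction p v≢g
... | no _ = refl

update-lipschitz : ∀ {E : Graph n} {g f} c → Isolated E g → Lipschitz f E → Lipschitz (update g c f) E
update-lipschitz c [] [] = []
update-lipschitz {E = (x , y) ∷ E} {g} {f} c ((p , q) ∷ i) ((a , b) ∷ l) =
  subst₂ (λ s t → s ≤ suc t × t ≤ suc s) (sym (update-other p)) (sym (update-other q)) (a , b) ∷ update-lipschitz c i l

-- Each chain vertex receives one more than its predecessor. It was isolated before, so only the new
-- edge constrains this value.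
chain-potential : ∀ {E : Graph n} u gs → Unique (u ∷ gs) → All (Isolated E) gs → (f : Fin n → ℕ) → Lipschitz f E →
  Σ (Fin n → ℕ) λ f′ → Lipschitz f′ (chain E u gs) × f′ (finish u gs) ≡ length gs + f u × (∀ {v} → v ∉ gs → f′ v ≡ f v)
chain-potential u [] _ _ f lip = f , lip , refl , (λ _ → refl)
chain-potential {n} {E} u (g ∷ gs) ((u≢g ∷ u≢) ∷ (g≢ ∷ uniq)) (i ∷ is) f lip
  with chain-potential g gs (g≢ ∷ uniq) (isolated-∷ u≢ g≢ is) (update g (suc (f u)) f)
         (subst₂ (λ s t → s ≤ suc t × t ≤ suc s) (sym (update-other u≢g)) (sym (update-at g (suc (f u)) f))
            (≤-trans (n≤1+n _) (n≤1+n _) , ≤-refl) ∷ update-lipschitz (suc (f u)) i lip)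
... | f′ , lip′ , fin , rest = f′ , lip′ ,
      trans fin (trans (cong (length gs +_) (update-at g (suc (f u)) f)) (+-suc (length gs) (f u))) ,
      λ v∉ → trans (rest (v∉ ∘ there)) (update-other (v∉ ∘ here))

-- If the edge sets agree, their union is a single path. A path is a chain of fresh vertices over
-- the empty graph, hence `Good` and without cycles.
¬SamePath : ∀ {m} (xs ys : List (Fin n)) (eq : length xs ≡ n) (eq′ : length ys ≡ n) → 2 ≤ m → Unique xs →
  Creating (suc m) (nth xs eq) (nth ys eq′) → ¬ SamePath (nth xs eq) (nth ys eq′)
¬SamePath {m = m@(suc _)} [] ys refl eq′ _ _ (c , _) _ with c fzero
... | ()
¬SamePath {n} {m = m@(suc _)} (x ∷ xs) ys eq eq′ 2≤m u cyc same =
  Good⇒¬Cycle 2≤m (chain-good x xs u (All.universal (λ _ → []) xs) []) (ContainsCycle-map (suc m) conv cyc)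
  where
  conv : ∀ a b → (PathEdges (nth (x ∷ xs) eq) ∪E PathEdges (nth ys eq′)) a b → Edge (chain [] x xs) a b
  conv′ : ∀ {a b} → PathEdges (nth (x ∷ xs) eq) a b → Edge (chain [] x xs) a b
  conv′ p = [ Path-Adj (chain-path x xs) , swap ∘ Path-Adj (chain-path x xs) ]′ (PathEdges⇒Adj eq p)
  conv a b (inj₁ p) = conv′ p
  conv a b (inj₂ p) = conv′ (Equivalence.from (same a b) p)

-- Counting the outcomes of repeated choices

-- The number is exact, so that successive choices simply multiply. Instead of inequality, `R` may
-- be any witness of difference that can be carried through later choices.
record Outcomes {A : Set} (R : A → A → Set) (P : A → Set) (N : ℕ) : Set where
  constructor outcomes
  field
    list  : List A
    howMany : length list ≡ N
    valid : All P list
    apart : AllPairs R list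

open Outcomes

outcome : ∀ {A : Set} {R : A → A → Set} {P : A → Set} a → P a → Outcomes R P 1
outcome a p = outcomes [ a ] refl (p ∷ []) ([] ∷ [])

mapOutcomes : ∀ {A B : Set} {R : A → A → Set} {R′ : B → B → Set} {P : A → Set} {Q : B → Set} {N} (f : A → B) →
  (∀ {a} → P a → Q (f a)) → (∀ {a b} → R a b → R′ (f a) (f b)) → Outcomes R P N → Outcomes R′ Q N
mapOutcomes f p r (outcomes l c v a) =
  outcomes (map f l) (trans (length-map f l) c) (Allₚ.map⁺ (All.map p v)) (AllPairsₚ.map⁺ (AllPairs.map r a))

-- a ⊑ b records that the outcome b arises from the outcome a.
module _ {A B : Set} {R : A → A → Set} {R′ : B → B → Set} {P : A → Set} {Q : B → Set} {M : ℕ} (_⊑_ : A → B → Set)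
  (keep : ∀ {a a′ b b′} → R a a′ → a ⊑ b → a′ ⊑ b′ → R′ b b′)
  (step : ∀ a → P a → Outcomes R′ (λ b → Q b × a ⊑ b) M) where

  bind : ∀ {N} → Outcomes R P N → Outcomes R′ Q (N * M)
  bind (outcomes l refl v a) with go l v a
    where
    go : ∀ l → All P l → AllPairs R l → Outcomes R′ (λ b → Q b × Any (_⊑ b) l) (length l * M)
    go [] _ _ = outcomes [] refl [] []
    go (a ∷ l) (p ∷ ps) (r ∷ rs) = outcomes (list s ++ list t)
        (trans (length-++ (list s)) (cong₂ _+_ (howMany s) (howMany t)))
        (Allₚ.++⁺ (All.map (λ { (q , o) → q , here o }) (valid s)) (All.map (λ { (q , o) → q , there o }) (valid t)))
        (AllPairsₚ.++⁺ (apart s) (apart t) (All.map (λ { (_ , o) → All.map (λ { (_ , o′) → cross o r o′ }) (valid t) }) (valid s)))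
      where
      s = step a p
      t = go l ps rs
      cross : ∀ {b b′ l} → a ⊑ b → All (R a) l → Any (_⊑ b′) l → R′ b b′
      cross o (r ∷ _) (here o′) = keep r o o′
      cross o (_ ∷ r) (there o′) = cross o r o′
  ... | outcomes l′ c v′ a′ = outcomes l′ c (All.map proj₁ v′) a′

traverse : ∀ {A B : Set} {R : A → A → Set} {R′ : B → B → Set} {P : A → Set} {Q : B → Set} {N} (_⊑_ : A → B → Set) →
  (∀ {a a′ b b′} → R a a′ → a ⊑ b → a′ ⊑ b′ → R′ b b′) →
  (∀ a → P a → Σ B λ b → Q b × a ⊑ b) → Outcomes R P N → Outcomes R′ Q N
traverse {N = N} _⊑_ keep f o = subst (Outcomes _ _) (*-identityʳ N)
  (bind _⊑_ keep (λ a p → outcome (proj₁ (f a p)) (proj₂ (f a p))) o)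

-- Permutations and block decompositions of lists

Unique-resp-↭ : ∀ {A : Set} {xs ys : List A} → xs ↭ ys → Unique xs → Unique ys
Unique-resp-↭ Perm.refl u = u
Unique-resp-↭ (Perm.prep x p) (q ∷ u) = All-resp-↭ p q ∷ Unique-resp-↭ p u
Unique-resp-↭ (Perm.swap x y p) ((x≢y ∷ qx) ∷ (qy ∷ u)) =
  ((x≢y ∘ sym) ∷ All-resp-↭ p qy) ∷ (All-resp-↭ p qx ∷ Unique-resp-↭ p u)
Unique-resp-↭ (Perm.trans p q) u = Unique-resp-↭ q (Unique-resp-↭ p u)

Unique-++⁻ : ∀ {A : Set} (xs : List A) {ys} → Unique (xs ++ ys) → Unique xs × Unique ys × (∀ {v} → v ∈ xs → v ∉ ys)
Unique-++⁻ [] u = [] , u , λ ()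
Unique-++⁻ (x ∷ xs) (p ∷ u) with Unique-++⁻ xs u
... | u₁ , u₂ , d = Allₚ.++⁻ˡ xs p ∷ u₁ , u₂ ,
  λ { (here refl) v∈ → All.lookup (Allₚ.++⁻ʳ xs p) v∈ refl ; (there q) → d q }

concat-↭ : ∀ {A : Set} {xss yss : List (List A)} → xss ↭ yss → concat xss ↭ concat yss
concat-↭ Perm.refl = ↭-refl
concat-↭ (Perm.prep xs p) = Permₚ.++⁺ˡ xs (concat-↭ p)
concat-↭ (Perm.swap xs ys p) = ↭-trans (Permₚ.++⁺ˡ xs (Permₚ.++⁺ˡ ys (concat-↭ p))) (shifts xs ys)
concat-↭ (Perm.trans p q) = ↭-trans (concat-↭ p) (concat-↭ q)

record Split {A : Set} (q s : ℕ) (xs : List A) : Set where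
  field
    blocks  : List (List A)
    rest    : List A
    split   : concat blocks ++ rest ≡ xs
    number  : length blocks ≡ q
    size    : All (λ b → length b ≡ s) blocks
    remains : length rest ≡ length xs ∸ q * s

splitBlocks : ∀ {A : Set} q s (xs : List A) → q * s ≤ length xs → Split q s xs
splitBlocks zero s xs _ = record { blocks = [] ; rest = xs ; split = refl ; number = refl ; size = [] ; remains = refl }
splitBlocks (suc q) s xs le = record
  { blocks = take s xs ∷ blocks ; rest = rest
  ; split = trans (++-assoc (take s xs) (concat blocks) rest) (trans (cong (take s xs ++_) split) (take++drop≡id s xs))
  ; number = cong suc number
  ; size = trans (length-take s xs) (m≤n⇒m⊓n≡m (≤-trans (m≤m+n s (q * s)) le)) ∷ size
  ; remains = trans remains (trans (cong (_∸ q * s) (length-drop s xs)) (∸-+-assoc (length xs) s (q * s)))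
  }
  where
  open Split (splitBlocks q s (drop s xs) (subst₂ _≤_ (m+n∸m≡n s (q * s)) (sym (length-drop s xs)) (∸-monoˡ-≤ s le)))

-- Lower bound: permuting blocks

-- Before the first difference the two orders agree literally, so the two differing blocks are
-- preceded by the same separator.
data Differ {A : Set} (R : A → A → Set) : List A → List A → Set where
  here  : ∀ {x y xs ys} → R x y → Differ R (x ∷ xs) (y ∷ ys)
  there : ∀ {x xs ys} → Differ R xs ys → Differ R (x ∷ xs) (x ∷ ys)

module _ {A : Set} {R : A → A → Set} (R-sym : ∀ {x y} → R x y → R y x) where

  picks : ∀ xs → AllPairs R xs →
    Outcomes (λ a b → R (proj₁ a) (proj₁ b)) (λ a → proj₁ a ∷ proj₂ a ↭ xs × AllPairs R (proj₂ a)) (length xs)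
  picks [] _ = outcomes [] refl [] []
  picks (x ∷ xs) (r ∷ rs) with picks xs rs
  ... | outcomes l c v a = outcomes ((x , xs) ∷ map (λ { (y , ys) → y , x ∷ ys }) l) (cong suc (trans (length-map _ l) c))
    ((↭-refl , rs) ∷ Allₚ.map⁺ (All.map (λ { {y , ys} (p , q) →
        ↭-trans (↭-swap y x ↭-refl) (↭-prep x p) , All.tail (All-resp-↭ (↭-sym p) r) ∷ q }) v))
    (Allₚ.map⁺ (All.map (λ { {y , ys} (p , _) → All.head (All-resp-↭ (↭-sym p) r) }) v) ∷ AllPairsₚ.map⁺ a)

  -- Orders with different heads differ at once, those with equal heads further on by induction; the
  -- choices of the head contribute the factors of the factorial.
  orderings : ∀ l xs → length xs ≡ l → AllPairs R xs → Outcomes (Differ R) (_↭ xs) (l !)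
  orderings zero [] _ _ = outcome [] ↭-refl
  orderings (suc l) xs eq rs = bind (λ a ys → ∃ λ zs → ys ≡ proj₁ a ∷ zs)
    (λ { r (_ , refl) (_ , refl) → here r })
    (λ { (x , ys) (p , rs′) → mapOutcomes (x ∷_) (λ q → ↭-trans (↭-prep x q) p , _ , refl) there
           (orderings l ys (suc-inj (trans (↭-length p) eq)) rs′) })
    (subst (Outcomes _ _) eq (picks xs rs))
    where
    suc-inj : ∀ {a b} → suc a ≡ suc b → a ≡ b
    suc-inj refl = refl

-- In use `rest` is nonempty: its first vertex closes the cell of the last block, as the next
-- separator does for the others.
weave : ∀ {A : Set} → List A → List A → List (List A) → List A
weave rest (a ∷ as) (X ∷ Xs) = a ∷ X ++ weave rest as Xs
weave rest _ _ = rest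

weave-↭ : ∀ {A : Set} (rest : List A) as Xs → length as ≡ length Xs → weave rest as Xs ↭ as ++ concat Xs ++ rest
weave-↭ rest [] [] _ = ↭-refl
weave-↭ rest (a ∷ as) (X ∷ Xs) eq = ↭-prep a (begin
  X ++ weave rest as Xs ↭⟨ Permₚ.++⁺ˡ X (weave-↭ rest as Xs (cong pred eq)) ⟩
  X ++ as ++ concat Xs ++ rest ↭⟨ shifts X as ⟩
  as ++ X ++ concat Xs ++ rest ≡⟨ cong (as ++_) (++-assoc X (concat Xs) rest) ⟨
  as ++ (X ++ concat Xs) ++ rest ∎)
  where open PermutationReasoning

Disjoint : ∀ {A : Set} → List A → List A → Set
Disjoint X Y = ∀ {v} → v ∈ X → v ∉ Y

Path-fromAdj : ∀ {E : EdgeSet n} x xs → (∀ {u v} → Adj u v (x ∷ xs) → E u v) → Path E x (x ∷ xs) (finish x xs)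
Path-fromAdj x [] _ = ⟨ x ⟩
Path-fromAdj x (y ∷ xs) f = f here ∷ Path-fromAdj y xs (f ∘ there)

Path-reverse : ∀ {E : EdgeSet n} → (∀ {u v} → E u v → E v u) → ∀ {s xs e} → Path E s xs e → Path E e (reverse xs) s
Path-reverse E-sym ⟨ x ⟩ = ⟨ x ⟩
Path-reverse E-sym {e = z} (_∷_ {x} {y} {ys} e p) = subst (λ l → Path _ z l x) (sym (unfold-reverse x ys))
  (Path-snoc (Path-reverse E-sym p) (E-sym e))

Adj-finish : ∀ {A : Set} (x : A) xs y zs → Adj (finish x xs) y (x ∷ xs ++ y ∷ zs)
Adj-finish x [] y zs = here
Adj-finish x (x′ ∷ xs) y zs = there (Adj-finish x′ xs y zs)

module _ {E : EdgeSet n} (E-sym : ∀ {u v} → E u v → E v u) (r : Fin n) (rs : List (Fin n)) (j : ℕ) where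

  firstOr : List (Fin n) → Fin n
  firstOr [] = r
  firstOr (a ∷ _) = a

  weave-head : ∀ as (Xs : List (List (Fin n))) → length as ≡ length Xs → ∃ λ tl → weave (r ∷ rs) as Xs ≡ firstOr as ∷ tl
  weave-head [] [] _ = _ , refl
  weave-head (a ∷ as) (X ∷ Xs) _ = _ , refl

  -- The cycle runs through `a`, `X`, `a′` and then `Y` backwards. With k = `suc (suc j)` this makes
  -- 2 + 2(k - 1) = 2k vertices.
  two-blocks-cycle : ∀ a a′ X Y → Unique (a ∷ X ++ [ a′ ]) → Unique (a ∷ Y ++ [ a′ ]) → Disjoint X Y →
    length X ≡ suc j → length Y ≡ suc j →
    (∀ {u v} → Adj u v (a ∷ X ++ [ a′ ]) → E u v) → (∀ {u v} → Adj u v (a ∷ Y ++ [ a′ ]) → E u v) →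
    ContainsCycle (2 * suc (suc j)) E
  two-blocks-cycle a a′ X (y ∷ Y) (aX ∷ uX) (aY ∷ uY) dis lX lY pX pY =
    cycle {xs = (a ∷ X) ++ a′ ∷ reverse (y ∷ Y)}
      (Path-++ (Path-fromAdj a X (pX ∘ Adj-++ˡ [ a′ ])) (pX (Adj-finish a X a′ [])) (E-sym (pY (there (Adj-finish y Y a′ []))) ∷ back))
      uniq len (E-sym (pY here))
    where
    back : Path E (finish y Y) (reverse (y ∷ Y)) y
    back = Path-reverse E-sym (Path-fromAdj y Y (λ q → pY (there (Adj-++ˡ [ a′ ] q))))
    len : length ((a ∷ X) ++ a′ ∷ reverse (y ∷ Y)) ≡ 2 * suc (suc j)
    len = trans (length-++ (a ∷ X)) (cong₂ _+_ (cong suc lX)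
      (trans (cong suc (trans (length-reverse (y ∷ Y)) lY)) (sym (+-identityʳ _))))
    rev∈ : ∀ {v} → v ∈ reverse (y ∷ Y) → v ∈ y ∷ Y
    rev∈ = reverse⁻
    uX⁻ = Unique-++⁻ X uX
    uY⁻ = Unique-++⁻ (y ∷ Y) uY
    uniq : Unique ((a ∷ X) ++ a′ ∷ reverse (y ∷ Y))
    uniq = Uniqueₚ.++⁺ (Allₚ.++⁻ˡ X aX ∷ proj₁ uX⁻)
        (All.tabulate (λ {v} v∈ → λ { refl → proj₂ (proj₂ uY⁻) (rev∈ v∈) (here refl) }) ∷
           Unique-resp-↭ (↭-sym (↭-reverse (y ∷ Y))) (proj₁ uY⁻))
        λ { (here refl , here refl) → All.head (Allₚ.++⁻ʳ X aX) refl
          ; (here refl , there q) → All.lookup (Allₚ.++⁻ˡ (y ∷ Y) aY) (rev∈ q) refl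
          ; (there p , here refl) → proj₂ (proj₂ uX⁻) p (here refl)
          ; (there p , there q) → dis p (rev∈ q) }

  weave-cycle : ∀ as {Xs Ys} → Differ Disjoint Xs Ys → length as ≡ length Xs → length as ≡ length Ys →
    All (λ X → length X ≡ suc j) Xs → All (λ X → length X ≡ suc j) Ys →
    Unique (weave (r ∷ rs) as Xs) → Unique (weave (r ∷ rs) as Ys) →
    (∀ {u v} → Adj u v (weave (r ∷ rs) as Xs) → E u v) → (∀ {u v} → Adj u v (weave (r ∷ rs) as Ys) → E u v) →
    ContainsCycle (2 * suc (suc j)) E
  weave-cycle (a ∷ as) (there {x = X} d) eX eY (_ ∷ lX) (_ ∷ lY) (_ ∷ uX) (_ ∷ uY) pX pY =
    weave-cycle as d (cong pred eX) (cong pred eY) lX lY (proj₁ (proj₂ (Unique-++⁻ X uX))) (proj₁ (proj₂ (Unique-++⁻ X uY)))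
      (pX ∘ there ∘ Adj-++ʳ X) (pY ∘ there ∘ Adj-++ʳ X)
  weave-cycle (a ∷ as) (here {x = X} {y = Y} {xs = Xs} {ys = Ys} d) eX eY (lX ∷ _) (lY ∷ _) uX uY pX pY
    with weave (r ∷ rs) as Xs | weave-head as Xs (cong pred eX) | weave (r ∷ rs) as Ys | weave-head as Ys (cong pred eY)
  ... | _ | tX , refl | _ | tY , refl = two-blocks-cycle a _ X Y (cut X tX uX) (cut Y tY uY) d lX lY
      (λ q → pX (extend X tX q)) (λ q → pY (extend Y tY q))
    where
    shape : ∀ X {h : Fin n} t → a ∷ X ++ h ∷ t ≡ (a ∷ X ++ [ h ]) ++ t
    shape X t = cong (a ∷_) (sym (++-assoc X [ _ ] t))
    cut : ∀ X {h} t → Unique (a ∷ X ++ h ∷ t) → Unique (a ∷ X ++ [ h ])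
    cut X t u = proj₁ (Unique-++⁻ (a ∷ X ++ [ _ ]) (subst Unique (shape X t) u))
    extend : ∀ X {h} t {u v} → Adj u v (a ∷ X ++ [ h ]) → Adj u v (a ∷ X ++ h ∷ t)
    extend X t q = subst (Adj _ _) (sym (shape X t)) (Adj-++ˡ t q)

blocks-disjoint : ∀ {A : Set} (Bs : List (List A)) → Unique (concat Bs) → AllPairs Disjoint Bs
blocks-disjoint [] _ = []
blocks-disjoint (B ∷ Bs) u with Unique-++⁻ B u
... | _ , u′ , d = All.tabulate (λ {B′} B′∈ v∈ v∈′ → d v∈ (∈-concat⁺′ v∈′ B′∈)) ∷ blocks-disjoint Bs u′

length-allFin : ∀ n → length (allFin n) ≡ n
length-allFin n = length-tabulate {n = n} id

-- The room needed is `q` cells, each a separator with its block and thus of size `suc (suc j)`,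
-- plus one vertex closing the last cell.
blocks-family : ∀ n j q → 1 ≤ j → suc (q * suc (suc j)) ≤ n →
  Σ (CreatingFamily n (2 * suc (suc j))) λ F → length (CreatingFamily.paths F) ≡ q !
blocks-family n j q 1≤j le = build (Split.rest S₂) refl
  where
  S₁ : Split 1 q (allFin n)
  S₁ = splitBlocks 1 q (allFin n) (subst (1 * q ≤_) (sym (length-allFin n))
         (≤-trans (≤-trans (≤-reflexive (*-identityˡ q)) (≤-trans (m≤m*n q (suc (suc j))) (n≤1+n _))) le))
  module S₁ = Split S₁
  as : List (Fin n)
  as = concat S₁.blocks
  lr : length S₁.rest ≡ n ∸ q
  lr = trans S₁.remains (cong₂ _∸_ (length-allFin n) (*-identityˡ q))
  las : length as ≡ q
  las = one S₁.blocks S₁.number S₁.size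
    where
    one : (Bs : List (List (Fin n))) → length Bs ≡ 1 → All (λ b → length b ≡ q) Bs → length (concat Bs) ≡ q
    one (B ∷ []) _ (p ∷ []) = trans (length-++ B) (trans (+-identityʳ _) p)
  qj : q + q * suc j < n
  qj = subst (_< n) (*-suc q (suc j)) le
  S₂ : Split q (suc j) S₁.rest
  S₂ = splitBlocks q (suc j) S₁.rest (subst (q * suc j ≤_) (sym lr) (m+n≤o⇒m≤o∸n (q * suc j) (subst (_≤ n) (+-comm q (q * suc j)) (<⇒≤ qj))))
  module S₂ = Split S₂
  all↭ : as ++ concat S₂.blocks ++ S₂.rest ≡ allFin n
  all↭ = trans (cong (as ++_) S₂.split) S₁.split
  u-all : Unique (as ++ concat S₂.blocks ++ S₂.rest)
  u-all = subst Unique (sym all↭) (Uniqueₚ.allFin⁺ n)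
  dis : AllPairs Disjoint S₂.blocks
  dis = blocks-disjoint S₂.blocks (proj₁ (Unique-++⁻ (concat S₂.blocks) (proj₁ (proj₂ (Unique-++⁻ as u-all)))))
  build : ∀ rest → rest ≡ S₂.rest → Σ (CreatingFamily n (2 * suc (suc j))) λ F → length (CreatingFamily.paths F) ≡ q !
  build [] eq = contradiction (trans (cong length eq) (trans S₂.remains (cong (_∸ q * suc j) lr)))
                  (<⇒≢ (subst (0 <_) (sym (∸-+-assoc n q (q * suc j))) (m<n⇒0<n∸m qj)))
  build (r ∷ rs) eq = record { paths = list O ; ham = valid O ; distinct = AllPairs.map proj₁ (apart O)
                             ; creating = AllPairs.map proj₂ (apart O) } , howMany O
    where
    Good-order : List (List (Fin n)) → (Fin n → Fin n) → Set
    Good-order Xs v = Xs ↭ S₂.blocks × Σ (length (weave (r ∷ rs) as Xs) ≡ n) λ e → v ≡ nth (weave (r ∷ rs) as Xs) e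
    weave↭ : ∀ {Xs} → Xs ↭ S₂.blocks → weave (r ∷ rs) as Xs ↭ allFin n
    weave↭ {Xs} p = ↭-trans (weave-↭ (r ∷ rs) as Xs (trans las (sym (trans (↭-length p) S₂.number))))
      (↭-trans (Permₚ.++⁺ˡ as (Permₚ.++⁺ʳ (r ∷ rs) (concat-↭ p))) (↭-reflexive (trans (cong (λ z → as ++ concat S₂.blocks ++ z) eq) all↭)))
    u-weave : ∀ {Xs} → Xs ↭ S₂.blocks → Unique (weave (r ∷ rs) as Xs)
    u-weave p = Unique-resp-↭ (↭-sym (weave↭ p)) (Uniqueₚ.allFin⁺ n)
    full : ∀ {Xs} → Xs ↭ S₂.blocks → length (weave (r ∷ rs) as Xs) ≡ n
    full p = trans (↭-length (weave↭ p)) (length-allFin n)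
    len : ∀ {Xs} → Xs ↭ S₂.blocks → length as ≡ length Xs
    len p = trans las (sym (trans (↭-length p) S₂.number))
    related : ∀ {Xs Ys v w} → Differ Disjoint Xs Ys → Good-order Xs v → Good-order Ys w →
      (¬ SamePath v w) × Creating (2 * suc (suc j)) v w
    related {Xs} {Ys} d (p , e , refl) (p′ , e′ , refl) =
      ¬SamePath {m = suc (j + 1 * suc (suc j))} (weave (r ∷ rs) as Xs) (weave (r ∷ rs) as Ys) e e′ (s≤s (≤-trans 1≤j (m≤m+n j _))) (u-weave p) cr , cr
      where
      cr : Creating (2 * suc (suc j)) (nth (weave (r ∷ rs) as Xs) e) (nth (weave (r ∷ rs) as Ys) e′)
      cr = weave-cycle (Sum.map PathEdges-sym PathEdges-sym) r rs j as d (len p) (len p′)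
        (All-resp-↭ (↭-sym p) S₂.size) (All-resp-↭ (↭-sym p′) S₂.size) (u-weave p) (u-weave p′)
        (inj₁ ∘ Adj⇒PathEdges e) (inj₂ ∘ Adj⇒PathEdges e′)
    O : Outcomes (λ v w → (¬ SamePath v w) × Creating (2 * suc (suc j)) v w) (IsHamSeq n) (q !)
    O = traverse Good-order related
      (λ Xs p → nth (weave (r ∷ rs) as Xs) (full p) , nth-injective {xs = weave (r ∷ rs) as Xs} (full p) (u-weave p) , p , full p , refl)
      (orderings {R = Disjoint} (λ d v∈ v∈′ → d v∈′ v∈) q S₂.blocks S₂.number dis)

-- Upper bound: clique–coclique with colours

-- A missed value could be punched out of the codomain, leaving an injection into a smaller `Fin`.
injective⇒surjective : ∀ {n} {v : Fin n → Fin n} → Injective _≡_ _≡_ v → ∀ y → ∃ λ x → v x ≡ y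
injective⇒surjective {suc n} {v} inj y with anyFin? (λ x → v x ≟ y)
... | yes p = p
... | no ¬p = contradiction (injective⇒≤ {f = λ x → punchOut {i = y} {j = v x} (λ q → ¬p (x , sym q))}
                (λ {a} {b} q → inj (punchOut-injective (λ r → ¬p (a , sym r)) (λ r → ¬p (b , sym r)) q))) 1+n≰n

AllPairs-lookup : ∀ {A : Set} {R : A → A → Set} {xs} → AllPairs R xs → ∀ i j → i ≢ j →
  R (lookup xs i) (lookup xs j) ⊎ R (lookup xs j) (lookup xs i)
AllPairs-lookup (p ∷ ps) fzero fzero i≢j = contradiction refl i≢j
AllPairs-lookup (p ∷ ps) fzero (fsuc j) _ = inj₁ (All.lookup p (∈-lookup j))
AllPairs-lookup (p ∷ ps) (fsuc i) fzero _ = inj₂ (All.lookup p (∈-lookup i))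
AllPairs-lookup (p ∷ ps) (fsuc i) (fsuc j) i≢j = AllPairs-lookup ps i j (i≢j ∘ cong fsuc)

PathEdges-image : ∀ {v w : Fin n → Fin n} (τ : Fin n → Fin n) → (∀ i → τ (v i) ≡ w i) →
  ∀ {x y} → PathEdges v x y → PathEdges w (τ x) (τ y)
PathEdges-image τ h (i , j , p , inj₁ (refl , refl)) = i , j , p , inj₁ (sym (h i) , sym (h j))
PathEdges-image τ h (i , j , p , inj₂ (refl , refl)) = i , j , p , inj₂ (sym (h i) , sym (h j))

ContainsCycle-image : ∀ m {E F : EdgeSet n} (τ : Fin n → Fin n) → Injective _≡_ _≡_ τ →
  (∀ x y → E x y → F (τ x) (τ y)) → ContainsCycle m E → ContainsCycle m F
ContainsCycle-image (suc r) τ inj f (c , c-inj , e , z) = τ ∘ c , c-inj ∘ inj , (λ i j p → f _ _ (e i j p)) , f _ _ z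

-- The relabelling of the i-th path of the family to the e-th coloured ordering, together with the colour,
-- determines i and e: two members of the family cannot be relabelled into a common cycle-free graph.
coloured-orderings-bound : ∀ {n M C p} {X : Set} (G : X → EdgeSet n) (enc : X → Fin C) → (∀ {x y} → enc x ≡ enc y → x ≡ y) →
  (F : CreatingFamily n M) →
  Outcomes {(Fin n → Fin n) × X} (λ a b → ¬ (∀ i → proj₁ a i ≡ proj₁ b i))
    (λ a → IsHamSeq n (proj₁ a) × (∀ {x y} → PathEdges (proj₁ a) x y → G (proj₂ a) x y) × ¬ ContainsCycle M (G (proj₂ a))) p →
  length (CreatingFamily.paths F) * p ≤ n ^ n * C
coloured-orderings-bound {n} {M} {C} {X = X} G enc enc-inj F (outcomes ws refl ok diff) = injective⇒≤ {f = code′} code′-inj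
  where
  open CreatingFamily F
  h = length paths
  p = length ws
  v : Fin h → Fin n → Fin n
  v = lookup paths
  v-inj : ∀ i → Injective _≡_ _≡_ (v i)
  v-inj i = All.lookup ham (∈-lookup i)
  v⁻¹ : Fin h → Fin n → Fin n
  v⁻¹ i y = proj₁ (injective⇒surjective (v-inj i) y)
  v∘v⁻¹ : ∀ i y → v i (v⁻¹ i y) ≡ y
  v∘v⁻¹ i y = proj₂ (injective⇒surjective (v-inj i) y)
  w : Fin p → Fin n → Fin n
  w e = proj₁ (lookup ws e)
  col : Fin p → X
  col e = proj₂ (lookup ws e)
  w-ok : ∀ e → _
  w-ok e = All.lookup ok (∈-lookup e)
  τ : Fin h → Fin p → Fin n → Fin n
  τ i e y = w e (v⁻¹ i y)
  τ-inj : ∀ i e → Injective _≡_ _≡_ (τ i e)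
  τ-inj i e {x} {y} eq = trans (sym (v∘v⁻¹ i x)) (trans (cong (v i) (proj₁ (w-ok e) eq)) (v∘v⁻¹ i y))
  τ∘v : ∀ i e x → τ i e (v i x) ≡ w e x
  τ∘v i e x = cong (w e) (v-inj i (v∘v⁻¹ i (v i x)))
  code : Fin h → Fin p → Fin (n ^ n * C)
  -- All maps are counted, `n ^ n` instead of `n !`, at the price of a factor only exponential in
  -- `n`.
  code i e = combine (funToFin (τ i e)) (enc (col e))
  module _ i e i′ e′ (eq : code i e ≡ code i′ e′) where
    both : funToFin (τ i e) ≡ funToFin (τ i′ e′) × enc (col e) ≡ enc (col e′)
    both = combine-injective (funToFin (τ i e)) (enc (col e)) (funToFin (τ i′ e′)) (enc (col e′)) eq
    τ≗ : ∀ y → τ i e y ≡ τ i′ e′ y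
    τ≗ y = trans (sym (finToFun-funToFin (τ i e) y)) (trans (cong (λ c → finToFun c y) (proj₁ both)) (finToFun-funToFin (τ i′ e′) y))
    into : ∀ x y → (PathEdges (v i) x y ⊎ PathEdges (v i′) x y) → G (col e) (τ i e x) (τ i e y)
    into x y (inj₁ q) = proj₁ (proj₂ (w-ok e)) (PathEdges-image (τ i e) (τ∘v i e) q)
    into x y (inj₂ q) = subst (λ c → G c (τ i e x) (τ i e y)) (sym (enc-inj (proj₂ both)))
      (proj₁ (proj₂ (w-ok e′)) (PathEdges-image (τ i e) (λ x → trans (τ≗ (v i′ x)) (τ∘v i′ e′ x)) q))
    ¬cycle : ¬ ContainsCycle M (λ x y → PathEdges (v i) x y ⊎ PathEdges (v i′) x y)
    ¬cycle = proj₂ (proj₂ (w-ok e)) ∘ ContainsCycle-image M (τ i e) (τ-inj i e) into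
    i≡i′ : i ≡ i′
    i≡i′ with i ≟ i′
    ... | yes q = q
    ... | no i≢i′ = ⊥-elim ([ ¬cycle , ¬cycle ∘ ContainsCycle-map M (λ _ _ → swap) ]′ (AllPairs-lookup creating i i′ i≢i′))
    w≗ : i ≡ i′ → ∀ x → w e x ≡ w e′ x
    w≗ refl x = trans (sym (τ∘v i e x)) (trans (τ≗ (v i x)) (τ∘v i e′ x))
    e≡e′ : e ≡ e′
    e≡e′ with e ≟ e′
    ... | yes q = q
    ... | no e≢e′ = ⊥-elim ([ (λ d → d (w≗ i≡i′)) , (λ d → d (sym ∘ w≗ i≡i′)) ]′ (AllPairs-lookup diff e e′ e≢e′))
  code′ : Fin (h * p) → Fin (n ^ n * C)
  code′ x = code (proj₁ (remQuot {h} p x)) (proj₂ (remQuot {h} p x))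
  code′-inj : Injective _≡_ _≡_ code′
  code′-inj {x} {y} eq = trans (sym (combine-remQuot {h} p x)) (trans
    (cong₂ combine (i≡i′ (proj₁ (remQuot {h} p x)) _ _ _ eq) (e≡e′ (proj₁ (remQuot {h} p x)) _ (proj₁ (remQuot {h} p y)) _ eq)) (combine-remQuot {h} p y))

-- Upper bound: one layer of the graph

∈-extract : ∀ {A : Set} {x : A} {ys} → x ∈ ys → ∃ λ zs → ys ↭ x ∷ zs
∈-extract x∈ with ∈-∃++ x∈
... | as , bs , refl = as ++ bs , shift _ as bs

Unique-⊆-length : ∀ {A : Set} {xs ys : List A} → Unique xs → (∀ {x} → x ∈ xs → x ∈ ys) → length xs ≤ length ys
Unique-⊆-length {xs = []} _ _ = z≤n
Unique-⊆-length {xs = x ∷ xs} (p ∷ u) sub with ∈-extract (sub (here refl))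
... | zs , perm = ≤-trans (s≤s (Unique-⊆-length u (λ {y} y∈ → drop-head y∈ (∈-resp-↭ perm (sub (there y∈)))))) (≤-reflexive (sym (↭-length perm)))
  where
  drop-head : ∀ {y} → y ∈ xs → y ∈ x ∷ zs → y ∈ zs
  drop-head y∈ (here refl) = contradiction refl (All.lookup p y∈)
  drop-head y∈ (there q) = q

count : ∀ {A : Set} {P : Pred A 0ℓ} → Decidable P → List A → ℕ
count P? xs = length (filter P? xs)

module _ {A : Set} {P Q R : Pred A 0ℓ} (P? : Decidable P) (Q? : Decidable Q) (R? : Decidable R) where
  count-cover : ∀ xs → (∀ {x} → x ∈ xs → P x → Q x ⊎ R x) → count P? xs ≤ count Q? xs + count R? xs
  count-cover [] _ = z≤n
  count-cover (x ∷ xs) f with P? x | Q? x | R? x | count-cover xs (f ∘ there)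
  ... | no _ | no _ | no _ | ih = ih
  ... | no _ | no _ | yes _ | ih = ≤-trans ih (+-monoʳ-≤ (count Q? xs) (n≤1+n _))
  ... | no _ | yes _ | no _ | ih = m≤n⇒m≤1+n ih
  ... | no _ | yes _ | yes _ | ih = m≤n⇒m≤1+n (≤-trans ih (+-monoʳ-≤ (count Q? xs) (n≤1+n _)))
  ... | yes _ | yes _ | no _ | ih = s≤s ih
  ... | yes _ | yes _ | yes _ | ih = s≤s (≤-trans ih (+-monoʳ-≤ (count Q? xs) (n≤1+n _)))
  ... | yes _ | no _ | yes _ | ih = ≤-trans (s≤s ih) (≤-reflexive (sym (+-suc (count Q? xs) (count R? xs))))
  ... | yes p | no ¬q | no ¬r | _ = ⊥-elim ([ ¬q , ¬r ]′ (f (here refl) p))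

module _ {A : Set} (f : A → Fin n) where

  fibre : List A → Fin n → ℕ
  fibre xs k = count (λ x → f x ≟ k) xs

  fibre-∷-other : ∀ {x k} xs → f x ≢ k → fibre (x ∷ xs) k ≡ fibre xs k
  fibre-∷-other {x} {k} xs ne = cong length (filter-reject (λ x → f x ≟ k) {x} {xs} ne)

  fibre-∷-same : ∀ x xs → fibre (x ∷ xs) (f x) ≡ suc (fibre xs (f x))
  fibre-∷-same x xs = cong length (filter-accept (λ y → f y ≟ f x) {x} {xs} refl)

  sum-fibres-≤ : ∀ xs {ks} → Unique ks → sum (map (fibre xs) ks) ≤ length xs
  sum-fibres-≤ [] {ks} _ = ≤-reflexive (zeros ks)
    where
    zeros : ∀ ks → sum (map (fibre []) ks) ≡ 0
    zeros [] = refl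
    zeros (_ ∷ ks) = zeros ks
  sum-fibres-≤ (x ∷ xs) u = ≤-trans (once _ u) (s≤s (sum-fibres-≤ xs u))
    where
    none : ∀ ks → All (f x ≢_) ks → sum (map (fibre (x ∷ xs)) ks) ≡ sum (map (fibre xs) ks)
    none [] [] = refl
    none (k ∷ ks) (p ∷ ps) = cong₂ _+_ (fibre-∷-other xs p) (none ks ps)
    once : ∀ ks → Unique ks → sum (map (fibre (x ∷ xs)) ks) ≤ suc (sum (map (fibre xs) ks))
    once [] _ = z≤n
    once (k ∷ ks) (p ∷ u) with f x ≟ k
    ... | yes refl = ≤-reflexive (cong₂ _+_ refl (none ks p))
    ... | no ne = ≤-trans (+-monoʳ-≤ (fibre xs k) (once ks u)) (≤-reflexive (+-suc (fibre xs k) _))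

length*≤sum : ∀ {A : Set} {g : A → ℕ} {d} {ks} → All (λ k → d ≤ g k) ks → length ks * d ≤ sum (map g ks)
length*≤sum [] = z≤n
length*≤sum (p ∷ ps) = +-mono-≤ p (length*≤sum ps)

deg-++ : ∀ (B E : Graph n) x → length (nbrs (B ++ E) x) ≡ (outdeg B x + indeg B x) + length (nbrs E x)
deg-++ B E x = begin
  length (nbrs (B ++ E) x) ≡⟨ length-nbrs (B ++ E) x ⟩
  outdeg (B ++ E) x + indeg (B ++ E) x
    ≡⟨ cong₂ _+_ (split (λ e → proj₁ e ≟ x)) (split (λ e → proj₂ e ≟ x)) ⟩
  (outdeg B x + outdeg E x) + (indeg B x + indeg E x) ≡⟨ interchange +-commutativeSemigroup (outdeg B x) (outdeg E x) (indeg B x) (indeg E x) ⟩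
  (outdeg B x + indeg B x) + (outdeg E x + indeg E x) ≡⟨ cong (outdeg B x + indeg B x +_) (length-nbrs E x) ⟨
  (outdeg B x + indeg B x) + length (nbrs E x) ∎
  where
  open ≡-Reasoning
  split : ∀ {P : Pred (Fin _ × Fin _) 0ℓ} (P? : Decidable P) → length (filter P? (B ++ E)) ≡ length (filter P? B) + length (filter P? E)
  split P? = trans (cong length (filter-++ P? B E)) (length-++ (filter P? B))

module Layer (m d : ℕ) {n : ℕ} where

  open import Data.List.Membership.DecPropositional (_≟_ {n}) using (_∈?_)

  Free : Graph n → Graph n → Fin n → Fin n → Set
  Free E B s y = y ∉ reach (B ++ E) m s × indeg B y < d

  free? : ∀ E B s y → Dec (Free E B s y)
  free? E B s y = ¬? (y ∈? reach (B ++ E) m s) ×-dec (indeg B y <? d)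

  -- Taking the first free vertex of `R` makes the result depend on the arguments alone. Returning
  -- `B` when none is free keeps the construction total, so no proof enters the graph.
  addEdge : Graph n → List (Fin n) → Fin n → Graph n → Graph n
  addEdge E R s B with any? (free? E B s) R
  ... | yes p = (s , proj₁ (find p)) ∷ B
  ... | no _ = B

  addEdges : Graph n → List (Fin n) → Fin n → ℕ → Graph n → Graph n
  addEdges E R s zero B = B
  addEdges E R s (suc j) B = addEdge E R s (addEdges E R s j B)

  layer : Graph n → List (Fin n) → List (Fin n) → Graph n
  layer E R [] = []
  layer E R (s ∷ S) = addEdges E R s (2 * d) (layer E R S)

  module _ (E : Graph n) (R : List (Fin n)) (R-unique : Unique R) (S₀ : List (Fin n)) (δ cap : ℕ)
    (deg : ∀ x → length (nbrs E x) ≤ δ) (room : (3 * d + δ) ^ m + cap ≤ length R) where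

    record Valid (B : Graph n) : Set where
      field
        good : Good m (B ++ E)
        into : All (λ e → proj₁ e ∈ S₀ × proj₂ e ∈ R) B
        ind  : ∀ y → indeg B y ≤ d
        out  : ∀ x → outdeg B x ≤ 2 * d

    -- Otherwise every vertex of `R` is near `s` or saturated. At most `(3 * d + δ) ^ m` are near,
    -- since the new edges add at most `2 * d` out and `d` in to each degree; so at least `cap`
    -- vertices are saturated and they alone absorb `cap * d` edges of `B`.
    exists-free : ∀ {B} s → Valid B → length B < cap * d → Any (Free E B s) R
    exists-free {B} s V lt with any? (free? E B s) R
    ... | yes p = p
    ... | no ¬p = contradiction lt (≤⇒≯ (≤-trans (*-monoˡ-≤ d cap≤) full≤))
      where
      open Valid V
      near? : Decidable (_∈ reach (B ++ E) m s)
      near? y = y ∈? reach (B ++ E) m s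
      full? : Decidable (λ y → d ≤ indeg B y)
      full? y = d ≤? indeg B y
      everything? : Decidable (_∈ R)
      everything? y = y ∈? R
      all≡ : filter everything? R ≡ R
      all≡ = filter-all everything? (All.tabulate id)
      cover : length R ≤ count near? R + count full? R
      cover = subst (λ l → length l ≤ count near? R + count full? R) all≡ (count-cover everything? near? full? R
        (λ {y} y∈ _ → case y y∈))
        where
        case : ∀ y → y ∈ R → (y ∈ reach (B ++ E) m s) ⊎ (d ≤ indeg B y)
        case y y∈ with near? y | full? y
        ... | yes q | _ = inj₁ q
        ... | no _ | yes q = inj₂ q
        ... | no ¬q | no ¬r = contradiction (lose y∈ (¬q , ≰⇒> ¬r)) ¬p
      near≤ : count near? R ≤ (3 * d + δ) ^ m
      near≤ = ≤-trans (Unique-⊆-length (Uniqueₚ.filter⁺ near? R-unique) (λ q → proj₂ (∈-filter⁻ near? {xs = R} q)))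
        (length-reach-≤ (λ x → subst (_≤ 3 * d + δ) (sym (deg-++ B E x))
          (+-mono-≤ (≤-trans (+-mono-≤ (out x) (ind x)) (≤-reflexive (+-comm (2 * d) d))) (deg x))) m s)
      cap≤ : cap ≤ count full? R
      cap≤ = +-cancelˡ-≤ ((3 * d + δ) ^ m) _ _ (≤-trans room (≤-trans cover (+-monoˡ-≤ _ near≤)))
      full≤ : count full? R * d ≤ length B
      full≤ = ≤-trans (length*≤sum (Allₚ.all-filter full? R)) (sum-fibres-≤ proj₂ B (Uniqueₚ.filter⁺ full? R-unique))

    record Added (s : Fin n) (B B′ : Graph n) (j : ℕ) : Set where
      field
        valid  : Valid B′
        size   : length B′ ≡ j + length B
        others : ∀ {x} → x ≢ s → outdeg B′ x ≡ outdeg B x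
        own    : outdeg B′ s ≡ j + outdeg B s

    addEdge-added : ∀ {B s} → s ∈ S₀ → Valid B → length B < cap * d → outdeg B s < 2 * d → Added s B (addEdge E R s B) 1
    addEdge-added {B} {s} s∈ V lt out< with any? (free? E B s) R
    ... | no ¬p = contradiction (exists-free s V lt) ¬p
    ... | yes p with find p
    ... | y , y∈ , y∉ , ind< = record
      { valid = record
        { good = add y∉ good
        ; into = (s∈ , y∈) ∷ into
        ; ind = ind′
        ; out = out′ }
      ; size = refl
      ; others = λ x≢s → fibre-∷-other proj₁ B (x≢s ∘ sym)
      ; own = fibre-∷-same proj₁ (s , y) B }
      where
      open Valid V
      ind′ : ∀ z → indeg ((s , y) ∷ B) z ≤ d
      ind′ z with y ≟ z
      ... | yes refl = ind<
      ... | no _ = ind z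
      out′ : ∀ x → outdeg ((s , y) ∷ B) x ≤ 2 * d
      out′ x with s ≟ x
      ... | yes refl = out<
      ... | no _ = out x

    addEdges-added : ∀ {B s} j → s ∈ S₀ → Valid B → outdeg B s ≡ 0 → j ≤ 2 * d → j + length B ≤ cap * d →
      Added s B (addEdges E R s j B) j
    addEdges-added zero _ V _ _ _ = record { valid = V ; size = refl ; others = λ _ → refl ; own = refl }
    addEdges-added {B} {s} (suc j) s∈ V o≡0 j< lt = record
      { valid = A₂.valid
      ; size = trans A₂.size (cong suc A₁.size)
      ; others = λ x≢s → trans (A₂.others x≢s) (A₁.others x≢s)
      ; own = trans A₂.own (cong suc A₁.own) }
      where
      module A₁ = Added (addEdges-added {B} {s} j s∈ V o≡0 (<⇒≤ j<) (<⇒≤ lt))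
      module A₂ = Added (addEdge-added s∈ A₁.valid (subst (_< cap * d) (sym A₁.size) lt)
        (subst (_< 2 * d) (sym (trans A₁.own (trans (cong (j +_) o≡0) (+-identityʳ j)))) j<))

    record Complete (S : List (Fin n)) : Set where
      field
        valid  : Valid (layer E R S)
        size   : length (layer E R S) ≡ length S * (2 * d)
        exact  : ∀ {x} → x ∈ S → outdeg (layer E R S) x ≡ 2 * d
        absent : ∀ {x} → x ∉ S → outdeg (layer E R S) x ≡ 0

    layer-complete : Good m E → ∀ S → Unique S → All (_∈ S₀) S → length S * (2 * d) ≤ cap * d → Complete S
    layer-complete gE [] _ _ _ = record
      { valid = record { good = gE ; into = [] ; ind = λ _ → z≤n ; out = λ _ → z≤n }
      ; size = refl ; exact = λ () ; absent = λ _ → refl }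
    layer-complete gE (s ∷ S) (p ∷ u) (s∈ ∷ S⊆) le = record
      { valid = A.valid
      ; size = trans A.size (cong (2 * d +_) C.size)
      ; exact = exact′
      ; absent = λ x∉ → trans (A.others (λ { refl → x∉ (here refl) })) (C.absent (x∉ ∘ there)) }
      where
      module C = Complete (layer-complete gE S u S⊆ (≤-trans (m≤n+m _ (2 * d)) le))
      s∉S : s ∉ S
      s∉S s∈S = All.lookup p s∈S refl
      module A = Added (addEdges-added (2 * d) s∈ C.valid (C.absent s∉S) ≤-refl (subst (λ z → 2 * d + z ≤ cap * d) (sym C.size) le))
      exact′ : ∀ {x} → x ∈ s ∷ S → outdeg (layer E R (s ∷ S)) x ≡ 2 * d
      exact′ (here refl) = trans A.own (trans (cong (2 * d +_) (C.absent s∉S)) (+-identityʳ _))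
      exact′ (there x∈) = trans (A.others (λ { refl → s∉S x∈ })) (C.exact x∈)

-- Every trip back and forth along the edge lengthens the walk by two.
reach-bounce : ∀ {E : Graph n} i {s y} → Edge E s y → y ∈ reach E (suc (i + i)) s
reach-bounce zero e = reach-snoc 0 (here refl) e
reach-bounce {E = E} (suc i) {s} {y} e = subst (λ ℓ → y ∈ reach E (suc (suc ℓ)) s) (sym (+-suc i i))
  (reach-snoc (suc (suc (i + i))) (reach-snoc (suc (i + i)) (reach-bounce i e) (swap e)) e)

-- A repeated edge would find its ends already joined by a walk of any odd length. This is where the
-- evenness of the cycle length `2k` enters, as the forbidden walks have length `2k - 1`. It makes
-- out-degrees count distinct targets.
Good⇒Unique : ∀ i {E : Graph n} → Good (suc (i + i)) E → Unique E
Good⇒Unique i [] = []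
Good⇒Unique i (add {x = x} {y} y∉ g) =
  All.tabulate (λ {e} e∈ → λ { refl → y∉ (reach-bounce i (inj₁ e∈)) }) ∷ Good⇒Unique i g

Unique-targets : ∀ {B : Graph n} s → Unique B → Unique (map proj₂ (outEdges B s))
Unique-targets {B = B} s u = go (outEdges B s) (Allₚ.all-filter (λ e → proj₁ e ≟ s) B) (Uniqueₚ.filter⁺ (λ e → proj₁ e ≟ s) u)
  where
  go : ∀ es → All (λ e → proj₁ e ≡ s) es → Unique es → Unique (map proj₂ es)
  go [] _ _ = []
  go ((_ , y) ∷ es) (refl ∷ ps) (q ∷ u) = Allₚ.map⁺ (All.zipWith (λ { {(_ , z)} (refl , ne) refl → ne refl }) (ps , q)) ∷ go es ps u

fibre-split : ∀ {A : Set} {P : Pred A 0ℓ} (P? : Decidable P) (f : A → Fin n) xs k →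
  fibre f xs k ≤ fibre f (filter P? xs) k + fibre f (filter (¬? ∘ P?) xs) k
fibre-split P? f [] k = z≤n
fibre-split P? f (x ∷ xs) k with P? x | fibre-split P? f xs k
... | yes _ | ih with f x ≟ k
...   | yes _ = s≤s ih
...   | no _ = ih
fibre-split P? f (x ∷ xs) k | no _ | ih with f x ≟ k
...   | yes _ = ≤-trans (s≤s ih) (≤-reflexive (sym (+-suc (fibre f (filter P? xs) k) _)))
...   | no _ = ih

-- Upper bound: matchings in a layer

record Piece (n : ℕ) : Set where
  constructor piece
  field
    start end : Fin n
    body      : List (Fin n)

open Piece

IsPath : Graph n → Piece n → Set
IsPath E p = Path (Edge E) (start p) (body p) (end p)

joined : Piece n → Piece n → Piece n
joined p q = piece (start p) (end q) (body p ++ body q)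

bodies : List (Piece n) → List (Fin n)
bodies ps = concat (map body ps)

bodies-↭ : ∀ {ps qs : List (Piece n)} → ps ↭ qs → bodies ps ↭ bodies qs
bodies-↭ p = concat-↭ (Permₚ.map⁺ body p)

Linked : Fin n → Fin n → List (Piece n) → Set
Linked s y = Any (Adj s y ∘ body)

-- The witness is one vertex with two different successors. Pieces are only ever joined, never cut,
-- so it survives all later steps and still separates the final orderings.
Diff : List (Piece n) → List (Piece n) → Set
Diff ps qs = ∃ λ s → ∃ λ y → ∃ λ z → y ≢ z × Linked s y ps × Linked s z qs

infix 4 _⊑_
_⊑_ : List (Piece n) → List (Piece n) → Set
ps ⊑ qs = ∀ {s y} → Linked s y ps → Linked s y qs

Diff-⊑ : ∀ {ps ps′ qs qs′ : List (Piece n)} → Diff ps ps′ → ps ⊑ qs → ps′ ⊑ qs′ → Diff qs qs′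
Diff-⊑ (s , y , z , y≢z , a , b) f g = s , y , z , y≢z , f a , g b

module Matching (c d : ℕ) {n : ℕ} (E : Graph n) (B : Graph n) (B⊆E : ∀ {e} → e ∈ B → e ∈ E)
  (B-unique : Unique B) (R : List (Fin n)) (into : All (λ e → proj₂ e ∈ R) B) (ind : ∀ y → indeg B y ≤ d)
  (V : List (Fin n)) (total : ℕ) where

  open import Data.List.Membership.DecPropositional (_≟_ {n}) using (_∈?_)

  -- Sources are ends of pieces in `Src`, targets are starts of pieces in `Tgt`, and a joined piece
  -- rests in `Mrg` until the next layer. Every join thus involves two different pieces, and none
  -- can be closed into a cycle.
  record State (j : ℕ) (ps : List (Piece n)) : Set where
    field
      Src Tgt Mrg : List (Piece n)
      used        : List (Fin n)
      parts       : ps ↭ Src ++ Tgt ++ Mrg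
      sources     : length Src + j ≡ c + c
      used-count  : length used ≡ j
      ends        : Unique (map end Src)
      out         : All (λ p → outdeg B (end p) ≡ 2 * d) Src
      targets     : ∀ {y} → y ∈ R → y ∈ map start Tgt ⊎ y ∈ used
      paths       : All (IsPath E) ps
      cover       : bodies ps ↭ V
      pieces      : length ps + j ≡ total

  hit-count : ∀ ys → count (λ e → proj₂ e ∈? ys) B ≤ length ys * d
  hit-count [] = ≤-reflexive (cong length (filter-none (λ e → proj₂ e ∈? []) {B} (All.tabulate λ _ ())))
  hit-count (y ∷ ys) = ≤-trans
    (count-cover (λ e → proj₂ e ∈? (y ∷ ys)) (λ e → proj₂ e ≟ y) (λ e → proj₂ e ∈? ys) B
      (λ { _ (here p) → inj₁ p ; _ (there p) → inj₂ p }))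
    (+-mono-≤ (ind y) (hit-count ys))

  unused : List (Fin n) → Graph n
  unused ys = filter (λ e → ¬? (proj₂ e ∈? ys)) B

  -- Double counting of the edges between the unmatched sources and the used targets.
  exists-source : ∀ {j ps} (st : State j ps) → j < c →
    Any (λ p → d ≤ outdeg (unused (State.used st)) (end p)) (State.Src st)
  exists-source {j} st j<c with any? (λ p → d ≤? outdeg (unused (State.used st)) (end p)) (State.Src st)
  ... | yes a = a
  ... | no ¬a = contradiction (≤-trans lower upper) (<⇒≱ strict)
    where
    open State st
    hits : Graph n
    hits = filter (λ e → proj₂ e ∈? used) B
    many : All (λ s → suc d ≤ outdeg hits s) (map end Src)
    many = Allₚ.map⁺ (All.zipWith (λ {p} → λ { (o , ¬d) → one p o ¬d }) (out , Allₚ.¬Any⇒All¬ Src ¬a))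
      where
      one : ∀ p → outdeg B (end p) ≡ 2 * d → ¬ (d ≤ outdeg (unused used) (end p)) → suc d ≤ outdeg hits (end p)
      one p o ¬d = +-cancelʳ-≤ d _ _ (≤-trans (≤-reflexive (cong suc (trans (cong (d +_) (sym (+-identityʳ d))) (sym o))))
        (≤-trans (s≤s (fibre-split (λ e → proj₂ e ∈? used) proj₁ B (end p)))
          (≤-trans (≤-reflexive (sym (+-suc _ _))) (+-monoʳ-≤ (outdeg hits (end p)) (≰⇒> ¬d)))))
    lower : length (map end Src) * suc d ≤ length hits
    lower = ≤-trans (length*≤sum many) (sum-fibres-≤ proj₁ hits ends)
    upper : length hits ≤ j * d
    upper = subst (λ z → length hits ≤ z * d) used-count (hit-count used)
    -- As `j < c`, more than `j` of the `2c` sources remain. Each would send at least `d + 1` edges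
    -- to the `j` used targets, which receive at most `d` each.
    j<Src : j < length (map end Src)
    j<Src = subst (j <_) (sym (length-map end Src)) (+-cancelʳ-< j j (length Src)
      (subst (j + j <_) (sym sources) (+-mono-< j<c j<c)))
    strict : j * d < length (map end Src) * suc d
    strict = <-≤-trans (s≤s (≤-trans (*-monoʳ-≤ j (n≤1+n d)) (m≤n+m (j * suc d) d))) (*-monoˡ-≤ (suc d) j<Src)

  module _ {j ps} (st : State j ps) (p : Piece n) (p∈ : p ∈ State.Src st) where
    open State st

    connect : ∀ y → (end p , y) ∈ B × y ∉ used → Σ (List (Piece n)) λ qs → (State (suc j) qs × ps ⊑ qs) × Linked (end p) y qs
    connect y (e∈ , y∉) with ∈-map⁻ start ([ id , (λ u → contradiction u y∉) ]′ (targets (All.lookup into e∈)))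
    ... | q , q∈ , refl with ∈-extract p∈ | ∈-extract q∈
    ... | Src′ , Src↭ | Tgt′ , Tgt↭ = joined p q ∷ others , (record
        { Src = Src′ ; Tgt = Tgt′ ; Mrg = joined p q ∷ Mrg ; used = start q ∷ used
        ; parts = ↭-sym (parts-shift (joined p q))
        ; sources = trans (+-suc (length Src′) j) (trans (cong (_+ j) (sym (↭-length Src↭))) sources)
        ; used-count = cong suc used-count
        ; ends = AllPairs.tail (Unique-resp-↭ (Permₚ.map⁺ end Src↭) ends)
        ; out = All.tail (All-resp-↭ Src↭ out)
        ; targets = targets′
        ; paths = Path-++ (All.head paths↭) (inj₁ (B⊆E e∈)) (All.head (All.tail paths↭)) ∷ All.tail (All.tail paths↭)
        ; cover = ↭-trans (↭-trans (↭-reflexive (++-assoc (body p) (body q) (bodies others))) (bodies-↭ (↭-sym ps↭))) cover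
        ; pieces = trans (+-suc _ j) (trans (cong (_+ j) (sym (↭-length ps↭))) pieces)
        } , grow) , here (Adj-join (All.head paths↭) (All.head (All.tail paths↭)))
      where
      others : List (Piece n)
      others = Src′ ++ Tgt′ ++ Mrg
      parts-shift : ∀ x → Src′ ++ Tgt′ ++ x ∷ Mrg ↭ x ∷ others
      parts-shift x = ↭-trans (Permₚ.++⁺ˡ Src′ (shift x Tgt′ Mrg)) (shift x Src′ (Tgt′ ++ Mrg))
      ps↭ : ps ↭ p ∷ q ∷ others
      ps↭ = ↭-trans parts (↭-trans (Permₚ.++⁺ Src↭ (Permₚ.++⁺ʳ Mrg Tgt↭)) (↭-prep p (shift q Src′ (Tgt′ ++ Mrg))))
      paths↭ : All (IsPath E) (p ∷ q ∷ others)
      paths↭ = All-resp-↭ ps↭ paths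
      targets′ : ∀ {y} → y ∈ R → y ∈ map start Tgt′ ⊎ y ∈ start q ∷ used
      targets′ y∈ with targets y∈
      ... | inj₂ u = inj₂ (there u)
      ... | inj₁ t with ∈-resp-↭ (Permₚ.map⁺ start Tgt↭) t
      ...   | here eq = inj₂ (here eq)
      ...   | there t′ = inj₁ t′
      grow : ps ⊑ joined p q ∷ others
      grow a with Any-resp-↭ ps↭ a
      ... | here a′ = here (Adj-++ˡ (body q) a′)
      ... | there (here a′) = here (Adj-++ʳ (body p) a′)
      ... | there (there a′) = there a′

  -- All options extend the same source, so different targets give it different successors. Cutting
  -- the candidates down to exactly `d` keeps the count uniform.
  match-step : ∀ {j ps} → State j ps → j < c → Outcomes Diff (λ qs → State (suc j) qs × ps ⊑ qs) d
  match-step {j} {ps} st j<c with find (exists-source st j<c)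
  ... | p , p∈ , d≤ = traverse {R = _≢_} (λ y qs → Linked (end p) y qs)
      (λ y≢z a b → end p , _ , _ , y≢z , a , b) (connect st p p∈)
      (outcomes ys ys-length ys-ok (Uniqueₚ.take⁺ d (Unique-targets (end p) (Uniqueₚ.filter⁺ _ B-unique))))
    where
    open State st
    candidates : List (Fin n)
    candidates = map proj₂ (outEdges (unused used) (end p))
    ys : List (Fin n)
    ys = take d candidates
    ys-length : length ys ≡ d
    ys-length = trans (length-take d candidates) (m≤n⇒m⊓n≡m (subst (d ≤_) (sym (length-map proj₂ (outEdges (unused used) (end p)))) d≤))
    ys-ok : All (λ y → (end p , y) ∈ B × y ∉ used) ys
    ys-ok = Allₚ.take⁺ d (Allₚ.map⁺ (All.tabulate ok))
      where
      ok : ∀ {e} → e ∈ outEdges (unused used) (end p) → (end p , proj₂ e) ∈ B × proj₂ e ∉ used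
      ok e∈ with ∈-filter⁻ (λ e → proj₁ e ≟ end p) {xs = unused used} e∈
      ... | e∈′ , refl = ∈-filter⁻ (λ e → ¬? (proj₂ e ∈? used)) {xs = B} e∈′

  matchings : ∀ {ps} → State 0 ps → ∀ j → j ≤ c → Outcomes Diff (λ qs → State j qs × ps ⊑ qs) (d ^ j)
  matchings {ps} st zero _ = outcome ps (st , id)
  matchings {ps} st (suc j) j<c = subst (Outcomes _ _) (*-comm (d ^ j) d)
    (bind _⊑_ Diff-⊑ (λ { qs (st′ , f) → mapOutcomes id (λ { (s , g) → (s , (λ {x} {y} a → g (f {x} {y} a))) , g }) id (match-step st′ j<c) }) (matchings st j (<⇒≤ j<c)))

Unique-selector : ∀ {A B : Set} (f : A → B) (g : A → List B) {ps} → All (λ p → f p ∈ g p) ps → Unique (concat (map g ps)) → Unique (map f ps)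
Unique-selector f g [] _ = []
Unique-selector f g {p ∷ ps} (i ∷ is) u with Unique-++⁻ (g p) u
... | _ , u′ , dis = Allₚ.map⁺ (All.zipWith (λ { {q} (q∈ , fq∈) eq → dis i (∈-concat⁺′ (subst (_∈ g q) (sym eq) fq∈) (∈-map⁺ g q∈)) }) (All.tabulate id , is))
      ∷ Unique-selector f g is u′

-- Upper bound: labels and the iteration of layers

module Layers (m d c i₀ : ℕ) (m-odd : m ≡ suc (i₀ + i₀)) {n : ℕ} (V : List (Fin n)) (V-unique : Unique V) where

  open Layer m d {n}
  open import Data.List.Membership.DecPropositional (_≟_ {n}) using (_∈?_)

  Code : Set
  Code = Fin (3 ^ n)

  S-label R-label : Fin 3
  S-label = fsuc fzero
  R-label = fsuc (fsuc fzero)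

  -- The vertices come in the order of `allFin n`, not of the pieces, so equal codes give literally
  -- equal inputs to the greedy construction.
  decode : Code → Fin 3 → List (Fin n)
  decode code l = filter (λ x → finToFun code x ≟ l) (allFin n)

  label : List (Fin n) → List (Fin n) → Fin n → Fin 3
  label S R x with x ∈? S | x ∈? R
  ... | yes _ | _ = S-label
  ... | no _ | yes _ = R-label
  ... | no _ | no _ = fzero

  encode : List (Fin n) → List (Fin n) → Code
  encode S R = funToFin (label S R)

  decode-unique : ∀ code l → Unique (decode code l)
  decode-unique code l = Uniqueₚ.filter⁺ (λ x → finToFun code x ≟ l) (Uniqueₚ.allFin⁺ n)

  decode⁻ : ∀ {S R x} l → x ∈ decode (encode S R) l → label S R x ≡ l
  decode⁻ {S} {R} {x} l x∈ = trans (sym (finToFun-funToFin (label S R) x))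
    (proj₂ (∈-filter⁻ (λ x → finToFun (encode S R) x ≟ l) {xs = allFin n} x∈))

  decode⁺ : ∀ {S R x} l → label S R x ≡ l → x ∈ decode (encode S R) l
  decode⁺ {S} {R} {x} l eq = ∈-filter⁺ (λ x → finToFun (encode S R) x ≟ l) (∈-allFin x) (trans (finToFun-funToFin (label S R) x) eq)

  decodeS⁻ : ∀ {S R x} → x ∈ decode (encode S R) S-label → x ∈ S
  decodeS⁻ {S} {R} {x} x∈ with x ∈? S | x ∈? R | decode⁻ {S} {R} S-label x∈
  ... | yes p | _ | _ = p
  ... | no _ | yes _ | ()
  ... | no _ | no _ | ()

  decodeS⁺ : ∀ {S R x} → x ∈ S → x ∈ decode (encode S R) S-label
  decodeS⁺ {S} {R} {x} x∈ = decode⁺ {S} {R} S-label lab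
    where
    lab : label S R x ≡ S-label
    lab with x ∈? S | x ∈? R
    ... | yes _ | _ = refl
    ... | no ¬p | _ = contradiction x∈ ¬p

  decodeR⁻ : ∀ {S R x} → x ∈ decode (encode S R) R-label → x ∈ R
  decodeR⁻ {S} {R} {x} x∈ with x ∈? S | x ∈? R | decode⁻ {S} {R} R-label x∈
  ... | yes p | _ | ()
  ... | no _ | yes p | _ = p
  ... | no _ | no _ | ()

  decodeR⁺ : ∀ {S R x} → x ∉ S → x ∈ R → x ∈ decode (encode S R) R-label
  decodeR⁺ {S} {R} {x} x∉ x∈ = decode⁺ {S} {R} R-label lab
    where
    lab : label S R x ≡ R-label
    lab with x ∈? S | x ∈? R
    ... | yes p | _ = contradiction p x∉
    ... | no _ | yes _ = refl
    ... | no _ | no ¬p = contradiction x∈ ¬p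

  -- The graph is recomputed from the labels alone, so that orderings with equal labels lie in a common graph.
  graphOf : ∀ {i} → Vec Code i → Graph n
  graphOf [] = []
  graphOf (code ∷ h) = layer (graphOf h) (decode code R-label) (decode code S-label) ++ graphOf h

  record LayerState (i : ℕ) (ps : List (Piece n)) : Set where
    field
      hist   : Vec Code i
      good   : Good m (graphOf hist)
      degree : ∀ x → length (nbrs (graphOf hist) x) ≤ i * (3 * d)
      inside : All (λ e → proj₁ e ∈ V × proj₂ e ∈ V) (graphOf hist)
      paths  : All (IsPath (graphOf hist)) ps
      cover  : bodies ps ↭ V
      pieces : length ps + i * c ≡ length V

  module _ (T : ℕ) (size : length V ≡ T * c + 7 * c) (ball : (T * (3 * d)) ^ m ≤ c) where

    layer-step : ∀ {i ps} → i < T → LayerState i ps → Outcomes Diff (λ qs → LayerState (suc i) qs × ps ⊑ qs) (d ^ c)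
    layer-step {i} {ps} i<T st = mapOutcomes id next id (matchings initial c ≤-refl)
      where
      open LayerState st
      E : Graph n
      E = graphOf hist
      Src Tgt : List (Piece n)
      Src = take (c + c) ps
      Tgt = drop (c + c) ps
      S R S′ R′ : List (Fin n)
      S = map end Src
      R = map start Tgt
      code : Code
      code = encode S R
      S′ = decode code S-label
      R′ = decode code R-label
      B : Graph n
      B = layer E R′ S′
      ps≡ : Src ++ Tgt ≡ ps
      ps≡ = take++drop≡id (c + c) ps
      ps-unique : Unique (bodies ps)
      ps-unique = Unique-resp-↭ (↭-sym cover) V-unique
      unique-parts : Unique (bodies Src ++ bodies Tgt)
      unique-parts = subst Unique (trans (cong bodies (sym ps≡)) (trans (cong concat (map-++ body Src Tgt)) (sym (concat-++ (map body Src) (map body Tgt))))) ps-unique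
      paths-parts : All (IsPath E) Src × All (IsPath E) Tgt
      paths-parts = Allₚ.++⁻ Src (subst (All (IsPath E)) (sym ps≡) paths)
      S-unique : Unique S
      S-unique = Unique-selector end body (All.map Path-end∈ (proj₁ paths-parts)) (proj₁ (Unique-++⁻ (bodies Src) unique-parts))
      R-unique : Unique R
      R-unique = Unique-selector start body (All.map Path-start∈ (proj₂ paths-parts)) (proj₁ (proj₂ (Unique-++⁻ (bodies Src) unique-parts)))
      end∈ : ∀ {ps} → All (IsPath E) ps → ∀ {x} → x ∈ map end ps → x ∈ bodies ps
      end∈ pp x∈ with ∈-map⁻ end x∈
      ... | p , p∈ , refl = ∈-concat⁺′ (Path-end∈ (All.lookup pp p∈)) (∈-map⁺ body p∈)
      start∈ : ∀ {ps} → All (IsPath E) ps → ∀ {x} → x ∈ map start ps → x ∈ bodies ps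
      start∈ pp x∈ with ∈-map⁻ start x∈
      ... | p , p∈ , refl = ∈-concat⁺′ (Path-start∈ (All.lookup pp p∈)) (∈-map⁺ body p∈)
      R∉S : ∀ {x} → x ∈ R → x ∉ S
      R∉S x∈R x∈S = proj₂ (proj₂ (Unique-++⁻ (bodies Src) unique-parts)) (end∈ (proj₁ paths-parts) x∈S) (start∈ (proj₂ paths-parts) x∈R)
      sub : ∀ {x} → x ∈ bodies Src ++ bodies Tgt → x ∈ V
      sub x∈ = ∈-resp-↭ cover (subst (_ ∈_) (trans (concat-++ (map body Src) (map body Tgt)) (trans (cong concat (sym (map-++ body Src Tgt))) (cong bodies ps≡))) x∈)
      S⊆V : ∀ {x} → x ∈ S′ → x ∈ V
      S⊆V x∈ = sub (∈-++⁺ˡ (end∈ (proj₁ paths-parts) (decodeS⁻ {S} {R} x∈)))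
      R⊆V : ∀ {x} → x ∈ R′ → x ∈ V
      R⊆V x∈ = sub (∈-++⁺ʳ (bodies Src) (start∈ (proj₂ paths-parts) (decodeR⁻ {S} {R} x∈)))
      -- The reserve of `7c` pieces comes from the needs of a layer: `2c` sources, `c` targets to
      -- allow for those near a source, and `4c` that the `2c * 2d` edges might saturate.
      many : c + 7 * c ≤ length ps
      many = +-cancelʳ-≤ (i * c) _ _ (subst (c + 7 * c + i * c ≤_) (sym (trans pieces size))
        (≤-trans (≤-reflexive rearrange) (+-monoˡ-≤ (7 * c) (*-monoˡ-≤ c i<T))))
        where
        rearrange : c + 7 * c + i * c ≡ suc i * c + 7 * c
        rearrange = trans (+-assoc c (7 * c) (i * c)) (trans (cong (c +_) (+-comm (7 * c) (i * c))) (sym (+-assoc c (i * c) (7 * c))))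
      length-Src : length Src ≡ c + c
      length-Src = trans (length-take (c + c) ps) (m≤n⇒m⊓n≡m (≤-trans (+-monoʳ-≤ c (m≤m+n c (6 * c))) many))
      length-S′ : length S′ ≤ c + c
      length-S′ = ≤-trans (Unique-⊆-length (decode-unique code S-label) (λ x∈ → decodeS⁻ {S} {R} x∈))
        (≤-reflexive (trans (length-map end Src) length-Src))
      length-R′ : c + 4 * c ≤ length R′
      length-R′ = ≤-trans (+-cancelˡ-≤ (c + c) _ _ (≤-trans total (≤-reflexive length-Tgt)))
        (≤-trans (≤-reflexive (sym (length-map start Tgt))) (Unique-⊆-length R-unique (λ x∈ → decodeR⁺ {S} {R} (R∉S x∈) x∈)))
        where
        length-Tgt : length ps ≡ (c + c) + length Tgt
        length-Tgt = trans (cong length (sym ps≡)) (trans (length-++ Src) (cong (_+ length Tgt) length-Src))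
        total : (c + c) + (c + 4 * c) ≤ length ps
        total = ≤-trans (≤-trans (≤-reflexive (+-assoc c c (c + 4 * c))) (+-monoʳ-≤ c (+-monoʳ-≤ c (*-monoˡ-≤ c (n≤1+n 5))))) many
      room : (3 * d + i * (3 * d)) ^ m + 4 * c ≤ length R′
      room = ≤-trans (+-monoˡ-≤ (4 * c) (≤-trans (^-monoˡ-≤ m (*-monoˡ-≤ (3 * d) i<T)) ball)) length-R′
      enough : length S′ * (2 * d) ≤ 4 * c * d
      enough = ≤-trans (*-monoˡ-≤ (2 * d) length-S′) (≤-reflexive (arith c d))
        where
        arith : ∀ c d → (c + c) * (2 * d) ≡ 4 * c * d
        arith = solve-∀
      full : Complete E R′ (decode-unique code R-label) S′ (i * (3 * d)) (4 * c) degree room S′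
      full = layer-complete E R′ (decode-unique code R-label) S′ (i * (3 * d)) (4 * c) degree room good S′
        (decode-unique code S-label) (All.tabulate id) enough
      open Complete full using (exact) renaming (valid to B-valid)
      open Valid B-valid using (into; ind) renaming (good to good′; out to out′)
      open Matching c d (B ++ E) B ∈-++⁺ˡ
        (proj₁ (Unique-++⁻ B (Good⇒Unique i₀ (subst (λ z → Good z (B ++ E)) m-odd good′)))) R′ (All.map proj₂ into) ind V (length ps)
      initial : State 0 ps
      initial = record
        { Src = Src ; Tgt = Tgt ; Mrg = [] ; used = []
        ; parts = ↭-reflexive (trans (sym ps≡) (cong (Src ++_) (sym (++-identityʳ Tgt))))
        ; sources = trans (+-identityʳ _) length-Src
        ; used-count = refl
        ; ends = S-unique
        ; out = All.tabulate (λ {p} p∈ → exact (decodeS⁺ {S} {R} (∈-map⁺ end p∈)))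
        ; targets = λ y∈ → inj₁ (decodeR⁻ {S} {R} y∈)
        ; paths = All.map (Path-map (Sum.map (∈-++⁺ʳ B) (∈-++⁺ʳ B))) paths
        ; cover = cover
        ; pieces = +-identityʳ _ }
      next : ∀ {qs} → State c qs × ps ⊑ qs → LayerState (suc i) qs × ps ⊑ qs
      next (fin , grow) = record
        { hist = code ∷ hist
        ; good = good′
        ; degree = λ x → subst (_≤ 3 * d + i * (3 * d)) (sym (deg-++ B E x))
            (+-mono-≤ (≤-trans (+-mono-≤ (out′ x) (ind x)) (≤-reflexive (+-comm (2 * d) d))) (degree x))
        ; inside = Allₚ.++⁺ (All.map (λ { (s∈ , y∈) → S⊆V s∈ , R⊆V y∈ }) into) inside
        ; paths = State.paths fin
        ; cover = State.cover fin
        ; pieces = trans (sym (+-assoc _ c (i * c))) (trans (cong (_+ i * c) (State.pieces fin)) pieces)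
        } , grow

    singletons : List (Piece n)
    singletons = map (λ x → piece x x [ x ]) V

    layers : ∀ i → i ≤ T → Outcomes Diff (LayerState i) ((d ^ c) ^ i)
    layers zero _ = outcome singletons record
      { hist = [] ; good = [] ; degree = λ _ → z≤n ; inside = []
      ; paths = Allₚ.map⁺ (All.universal (λ x → ⟨ x ⟩) V)
      ; cover = ↭-reflexive (bodies-singletons V)
      ; pieces = trans (+-identityʳ _) (length-map _ V) }
      where
      bodies-singletons : ∀ V → bodies (map (λ x → piece x x [ x ]) V) ≡ V
      bodies-singletons [] = refl
      bodies-singletons (x ∷ V) = cong (x ∷_) (bodies-singletons V)
    layers (suc i) i<T = subst (Outcomes _ _) (*-comm ((d ^ c) ^ i) (d ^ c))
      (bind _⊑_ Diff-⊑ (λ ps st → layer-step i<T st) (layers i (<⇒≤ i<T)))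

-- Upper bound: gluing the pieces

Path-overlap : ∀ {E : EdgeSet n} {s xs e ys z} → Path E s xs e → Path E e (e ∷ ys) z → Path E s (xs ++ ys) z
Path-overlap ⟨ x ⟩ q = q
Path-overlap (a ∷ p) q = a ∷ Path-overlap p q

Path-resp-≡ : ∀ {E : EdgeSet n} {s xs ys e} → xs ≡ ys → Path E s xs e → Path E s ys e
Path-resp-≡ refl p = p

finish∈ : ∀ {A : Set} (u : A) gs → finish u gs ∈ u ∷ gs
finish∈ u [] = here refl
finish∈ u (g ∷ gs) = there (finish∈ g gs)

-- Only the ends of the pieces enter, not their bodies, so the glued graph is determined by the
-- colour. The last chain is attached at one end only.
link : Graph n → List (Fin n × Fin n) → List (List (Fin n)) → Graph n
link E ((_ , e) ∷ []) (g ∷ _) = chain E e g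
link E ((_ , e) ∷ (s , e′) ∷ ps) (g ∷ gs) = link ((finish e g , s) ∷ chain E e g) ((s , e′) ∷ ps) gs
link E _ _ = E

arrange : List (Piece n) → List (List (Fin n)) → List (Fin n)
arrange (p ∷ ps) (g ∷ gs) = body p ++ g ++ arrange ps gs
arrange _ _ = []

ends-of : Piece n → Fin n × Fin n
ends-of p = start p , end p

arrange-↭ : ∀ (ps : List (Piece n)) gs → length ps ≡ length gs → arrange ps gs ↭ bodies ps ++ concat gs
arrange-↭ [] [] _ = ↭-refl
arrange-↭ (p ∷ ps) (g ∷ gs) eq = begin
  body p ++ g ++ arrange ps gs ↭⟨ Permₚ.++⁺ˡ (body p) (Permₚ.++⁺ˡ g (arrange-↭ ps gs (cong pred eq))) ⟩
  body p ++ g ++ bodies ps ++ concat gs ↭⟨ Permₚ.++⁺ˡ (body p) (shifts g (bodies ps)) ⟩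
  body p ++ bodies ps ++ g ++ concat gs ≡⟨ ++-assoc (body p) (bodies ps) (g ++ concat gs) ⟨
  (body p ++ bodies ps) ++ g ++ concat gs ∎
  where open PermutationReasoning

arrange-Linked : ∀ {s y : Fin n} ps gs → length ps ≡ length gs → Linked s y ps → Adj s y (arrange ps gs)
arrange-Linked (p ∷ ps) (g ∷ gs) eq (here a) = Adj-++ˡ (g ++ arrange ps gs) a
arrange-Linked (p ∷ ps) (g ∷ gs) eq (there a) = Adj-++ʳ (body p) (Adj-++ʳ g (arrange-Linked ps gs (cong pred eq) a))

-- A glue chain with more than m inner vertices cannot be traversed by a walk of length m,
-- so closing it up keeps the graph good.
module _ {n m : ℕ} where

  record LinkedUp (E : Graph n) (p : Piece n) (ps : List (Piece n)) (gs : List (List (Fin n))) : Set where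
    field
      good : Good (suc m) (link E (map ends-of (p ∷ ps)) gs)
      keep : ∀ {e} → e ∈ E → e ∈ link E (map ends-of (p ∷ ps)) gs
      last : Fin n
      path : Path (Edge (link E (map ends-of (p ∷ ps)) gs)) (start p) (arrange (p ∷ ps) gs) last

  link-good : ∀ {E : Graph n} p ps gs → length (p ∷ ps) ≡ length gs → Good (suc m) E → All (IsPath E) (p ∷ ps) →
    All (λ g → suc m < length g) gs → All (Isolated E) (concat gs) → Unique (concat gs) →
    All (λ p → start p ∉ concat gs × end p ∉ concat gs) (p ∷ ps) → LinkedUp E p ps gs
  link-good {E} p [] (g ∷ []) _ gE (pE ∷ []) _ iso uniq ((_ , e∉) ∷ []) = record
    { good = chain-good (end p) g fresh iso′ gE
    ; keep = chain-⊆ (end p) g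
    ; last = finish (end p) g
    ; path = Path-overlap (Path-map (Sum.map (chain-⊆ (end p) g) (chain-⊆ (end p) g)) pE)
               (Path-resp-≡ (cong (end p ∷_) (sym (++-identityʳ g))) (chain-path (end p) g)) }
    where
    iso′ : All (Isolated E) g
    iso′ = Allₚ.++⁻ˡ g iso
    fresh : Unique (end p ∷ g)
    fresh = All.tabulate (λ x∈ → λ { refl → e∉ (∈-++⁺ˡ x∈) }) ∷ proj₁ (Unique-++⁻ g uniq)
  link-good {E} p (q ∷ ps) (g ∷ gs) eq gE (pE ∷ psE) (long ∷ longs) iso uniq ((_ , e∉) ∷ (s∉ , e′∉) ∷ outs) = record
    { good = IH.good
    ; keep = IH.keep ∘ there ∘ chain-⊆ (end p) g
    ; last = IH.last
    ; path = Path-resp-≡ (++-assoc (body p) g _)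
        (Path-++ (Path-overlap (Path-map (Sum.map to to) pE) (Path-map (Sum.map (IH.keep ∘ there) (IH.keep ∘ there)) (chain-path (end p) g)))
                 (inj₁ (IH.keep (here refl))) IH.path) }
    where
    E₁ E₂ : Graph n
    E₁ = chain E (end p) g
    E₂ = (finish (end p) g , start q) ∷ E₁
    uniq⁻ = Unique-++⁻ g uniq
    fresh : Unique (end p ∷ g)
    fresh = All.tabulate (λ x∈ → λ { refl → e∉ (∈-++⁺ˡ x∈) }) ∷ proj₁ uniq⁻
    -- The potential is 0 on the old graph and climbs to `length g` at the far end of the chain.
    -- Since `start q` stays at 0, a walk back to it takes at least `length g` steps, more than
    -- `suc m`.
    potential = chain-potential (end p) g fresh (Allₚ.++⁻ˡ g iso) (λ _ → 0) (All.universal (λ _ → z≤n , z≤n) E)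
    far : start q ∉ reach E₁ (suc m) (finish (end p) g)
    far r = <⇒≱ long (subst₂ _≤_ (trans (proj₁ (proj₂ (proj₂ potential))) (+-identityʳ _))
      (trans (cong (suc m +_) (proj₂ (proj₂ (proj₂ potential)) (s∉ ∘ ∈-++⁺ˡ))) (+-identityʳ _))
      (reach-potential (proj₁ (proj₂ potential)) (suc m) r))
    iso₂ : All (Isolated E₂) (concat gs)
    iso₂ = All.tabulate (λ {h} h∈ → ((λ { refl → away h∈ (finish∈ (end p) g) }) , (λ { refl → s∉ (∈-++⁺ʳ g h∈) })) ∷
      chain-isolated (end p) g (away h∈) (All.lookup (Allₚ.++⁻ʳ g iso) h∈))
      where
      away : ∀ {h} → h ∈ concat gs → h ∉ end p ∷ g
      away h∈ (here refl) = e∉ (∈-++⁺ʳ g h∈)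
      away h∈ (there h∈g) = proj₂ (proj₂ uniq⁻) h∈g h∈
    linked : LinkedUp E₂ q ps gs
    linked = link-good {E₂} q ps gs (cong pred eq) (add far (chain-good (end p) g fresh (Allₚ.++⁻ˡ g iso) gE))
      (All.map (Path-map (Sum.map (there ∘ chain-⊆ (end p) g) (there ∘ chain-⊆ (end p) g))) psE) longs iso₂ (proj₁ (proj₂ uniq⁻))
      (All.map (λ { (a , b) → a ∘ ∈-++⁺ʳ g , b ∘ ∈-++⁺ʳ g }) ((s∉ , e′∉) ∷ outs))
    module IH = LinkedUp linked
    to : ∀ {e} → e ∈ E → e ∈ link E₂ (map ends-of (q ∷ ps)) gs
    to = IH.keep ∘ there ∘ chain-⊆ (end p) g

-- Upper bound: encoding colours and assembling the count

nth-ext : ∀ {A : Set} {k} (xs ys : List A) (p : length xs ≡ k) (q : length ys ≡ k) → (∀ i → nth xs p i ≡ nth ys q i) → xs ≡ ys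
nth-ext {k = zero} [] [] p q f = refl
nth-ext {k = suc k} (x ∷ xs) (y ∷ ys) p q f = cong₂ _∷_ (f fzero) (nth-ext xs ys (cong pred p) (cong pred q) (f ∘ fsuc))

encodeVec : ∀ {A : Set} {a k} → (A → Fin a) → Vec A k → Fin (a ^ k)
encodeVec f [] = fzero
encodeVec f (x ∷ xs) = combine (f x) (encodeVec f xs)

encodeVec-injective : ∀ {A : Set} {a k} (f : A → Fin a) → (∀ {x y} → f x ≡ f y → x ≡ y) →
  (xs ys : Vec A k) → encodeVec f xs ≡ encodeVec f ys → xs ≡ ys
encodeVec-injective f inj [] [] _ = refl
encodeVec-injective f inj (x ∷ xs) (y ∷ ys) eq with combine-injective (f x) (encodeVec f xs) (f y) (encodeVec f ys) eq
... | p , q = cong₂ _∷_ (inj p) (encodeVec-injective f inj xs ys q)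

toVec : ∀ {A : Set} {k} (xs : List A) → length xs ≡ k → Σ (Vec A k) λ v → toList v ≡ xs
toVec xs refl = fromList xs , toList∘fromList xs

module Counting (d c i₀ : ℕ) {n : ℕ} (V : List (Fin n)) (glues : List (List (Fin n))) (T : ℕ)
  (partition : V ++ concat glues ↭ allFin n) (V-size : length V ≡ T * c + 7 * c) (0<c : 0 < c)
  (glue-number : length glues ≡ 7 * c) (2≤m : 2 ≤ suc (i₀ + i₀))
  (long : All (λ g → suc (i₀ + i₀) < length g) glues) (ball : (T * (3 * d)) ^ suc (i₀ + i₀) ≤ c) where

  m : ℕ
  m = suc (i₀ + i₀)

  all-unique : Unique (V ++ concat glues)
  all-unique = Unique-resp-↭ (↭-sym partition) (Uniqueₚ.allFin⁺ n)

  open Layers m d c i₀ refl V (proj₁ (Unique-++⁻ V all-unique))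

  Colour : Set
  Colour = Vec Code T × Vec (Fin n × Fin n) (7 * c)

  G : Colour → EdgeSet n
  G (h , es) = Edge (link (graphOf h) (toList es) glues)

  enc : Colour → Fin ((3 ^ n) ^ T * (n * n) ^ (7 * c))
  enc (h , es) = combine (encodeVec id h) (encodeVec (uncurry combine) es)

  enc-injective : ∀ {x y} → enc x ≡ enc y → x ≡ y
  enc-injective {h , es} {h′ , es′} eq
    with combine-injective (encodeVec id h) (encodeVec (uncurry combine) es) (encodeVec id h′) (encodeVec (uncurry combine) es′) eq
  ... | p , q = cong₂ _,_ (encodeVec-injective id id h h′ p)
    (encodeVec-injective (uncurry combine) (λ { {a , b} {a′ , b′} r → cong₂ _,_ (proj₁ (combine-injective a b a′ b′ r)) (proj₂ (combine-injective a b a′ b′ r)) }) es es′ q)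

  Ordering : List (Piece n) → (Fin n → Fin n) × Colour → Set
  Ordering ps (w , _) = length ps ≡ length glues × Unique (arrange ps glues) × Σ (length (arrange ps glues) ≡ n) λ e → w ≡ nth (arrange ps glues) e

  -- In a list without repetitions the successor of `s` is unique, so equal orderings cannot give it
  -- both `y` and `z`.
  different : ∀ {ps qs a b} → Diff ps qs → Ordering ps a → Ordering qs b → ¬ (∀ i → proj₁ a i ≡ proj₁ b i)
  different {ps} {qs} (s , y , z , y≢z , l , l′) (eq , u , e , refl) (eq′ , _ , e′ , refl) same =
    y≢z (Adj-functional u (arrange-Linked ps glues eq l)
      (subst (Adj s z) (sym (nth-ext (arrange ps glues) (arrange qs glues) e e′ same)) (arrange-Linked qs glues eq′ l′)))

  Fits : (Fin n → Fin n) × Colour → Set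
  Fits a = IsHamSeq n (proj₁ a) × (∀ {x y} → PathEdges (proj₁ a) x y → G (proj₂ a) x y) × ¬ ContainsCycle (suc m) (G (proj₂ a))

  complete : ∀ ps → LayerState T ps → Σ ((Fin n → Fin n) × Colour) λ a → Fits a × Ordering ps a
  complete ps st = go ps refl
    where
    open LayerState st
    ps-number : length ps ≡ 7 * c
    ps-number = +-cancelʳ-≡ (T * c) _ _ (trans pieces (trans V-size (+-comm (T * c) (7 * c))))
    eq : length ps ≡ length glues
    eq = trans ps-number (sym glue-number)
    V∉ : ∀ {x} → x ∈ V → x ∉ concat glues
    V∉ = proj₂ (proj₂ (Unique-++⁻ V all-unique))
    isolated : All (Isolated (graphOf hist)) (concat glues)
    isolated = All.tabulate (λ {h} h∈ → All.map (λ { (a , b) → (λ { refl → V∉ a h∈ }) , (λ { refl → V∉ b h∈ }) }) inside)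
    body⊆V : ∀ {p x} → p ∈ ps → x ∈ body p → x ∈ V
    body⊆V p∈ x∈ = ∈-resp-↭ cover (∈-concat⁺′ x∈ (∈-map⁺ body p∈))
    outs : All (λ p → start p ∉ concat glues × end p ∉ concat glues) ps
    outs = All.tabulate (λ p∈ → V∉ (body⊆V p∈ (Path-start∈ (All.lookup paths p∈))) , V∉ (body⊆V p∈ (Path-end∈ (All.lookup paths p∈))))
    arranged : arrange ps glues ↭ allFin n
    arranged = ↭-trans (arrange-↭ ps glues eq) (↭-trans (Permₚ.++⁺ʳ (concat glues) cover) partition)
    unique : Unique (arrange ps glues)
    unique = Unique-resp-↭ (↭-sym arranged) (Uniqueₚ.allFin⁺ n)
    len : length (arrange ps glues) ≡ n
    len = trans (↭-length arranged) (length-allFin n)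
    es = toVec (map ends-of ps) (trans (length-map ends-of ps) ps-number)
    go : ∀ qs → qs ≡ ps → Σ ((Fin n → Fin n) × Colour) λ a → Fits a × Ordering ps a
    go [] refl = contradiction ps-number (<⇒≢ (≤-trans 0<c (m≤m+n c _)))
    go (p ∷ qs) refl = (nth (arrange ps glues) len , hist , proj₁ es) ,
        (nth-injective {xs = arrange ps glues} len unique , edges , acyclic) , eq , unique , len , refl
      where
      open LinkedUp (link-good p qs glues eq good paths long isolated (proj₁ (proj₂ (Unique-++⁻ V all-unique))) outs)
        renaming (good to good′)
      edges : ∀ {x y} → PathEdges (nth (arrange ps glues) len) x y → G (hist , proj₁ es) x y
      edges {x} {y} e = subst (λ l → Edge (link (graphOf hist) l glues) x y) (sym (proj₂ es))
        ([ Path-Adj path , swap ∘ Path-Adj path ]′ (PathEdges⇒Adj len e))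
      acyclic : ¬ ContainsCycle (suc m) (G (hist , proj₁ es))
      acyclic = subst (λ l → ¬ ContainsCycle (suc m) (Edge (link (graphOf hist) l glues))) (sym (proj₂ es)) (Good⇒¬Cycle 2≤m good′)

  bound : (F : CreatingFamily n (suc m)) →
    length (CreatingFamily.paths F) * (d ^ c) ^ T ≤ n ^ n * ((3 ^ n) ^ T * (n * n) ^ (7 * c))
  bound F = coloured-orderings-bound G enc enc-injective F
    (traverse Ordering (λ {ps} {qs} {a} {b} → different {ps} {qs} {a} {b}) complete (layers T V-size ball T ≤-refl))

-- The vertices are divided into `V`, which carries the pieces, and one chain for each of the `7c`
-- final pieces. A chain has at least `2k` vertices, one more than the length of a forbidden walk.
creating-family-bound : ∀ n k d c T → 2 ≤ k → 0 < c → T * c + 7 * c + (7 * c) * (2 * k) ≤ n →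
  (T * (3 * d)) ^ (2 * k ∸ 1) ≤ c → (F : CreatingFamily n (2 * k)) →
  length (CreatingFamily.paths F) * (d ^ c) ^ T ≤ n ^ n * ((3 ^ n) ^ T * (n * n) ^ (7 * c))
creating-family-bound n (suc i₀) d c T (s≤s 1≤i₀) 0<c fits ball F =
  go (Split.blocks Sp) refl
  where
  k = suc i₀
  v = T * c + 7 * c
  m≡ : 2 * k ≡ suc (suc (i₀ + i₀))
  m≡ = cong suc (trans (cong (i₀ +_) (+-identityʳ k)) (+-suc i₀ i₀))
  V rest : List (Fin n)
  V = take v (allFin n)
  rest = drop v (allFin n)
  V-size : length V ≡ v
  V-size = trans (length-take v (allFin n)) (m≤n⇒m⊓n≡m (subst (v ≤_) (sym (length-allFin n)) (≤-trans (m≤m+n v _) fits)))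
  Sp : Split (7 * c) (2 * k) rest
  Sp = splitBlocks (7 * c) (2 * k) rest (subst (7 * c * (2 * k) ≤_) (sym (trans (length-drop v (allFin n)) (cong (_∸ v) (length-allFin n))))
         (m+n≤o⇒m≤o∸n _ (subst (_≤ n) (+-comm v _) fits)))
  module Sp = Split Sp
  go : ∀ Bs → Bs ≡ Sp.blocks → length (CreatingFamily.paths F) * (d ^ c) ^ T ≤ n ^ n * ((3 ^ n) ^ T * (n * n) ^ (7 * c))
  go [] eq = contradiction (trans (cong length eq) Sp.number) (<⇒≢ (≤-trans 0<c (m≤m+n c _)))
  go (b ∷ Bs) eq = go′ F
    where
    glues : List (List (Fin n))
    -- The surplus vertices lengthen the first chain; only a lower bound on chain lengths matters.
    glues = (b ++ Sp.rest) ∷ Bs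
    partition : V ++ concat glues ↭ allFin n
    partition = ↭-trans (Permₚ.++⁺ˡ V reorder) (↭-reflexive (take++drop≡id v (allFin n)))
      where
      open PermutationReasoning
      reorder : concat glues ↭ rest
      reorder = begin
        (b ++ Sp.rest) ++ concat Bs ≡⟨ ++-assoc b Sp.rest (concat Bs) ⟩
        b ++ Sp.rest ++ concat Bs ↭⟨ Permₚ.++⁺ˡ b (Permₚ.++-comm Sp.rest (concat Bs)) ⟩
        b ++ concat Bs ++ Sp.rest ≡⟨ ++-assoc b (concat Bs) Sp.rest ⟨
        (b ++ concat Bs) ++ Sp.rest ≡⟨ cong (λ z → concat z ++ Sp.rest) eq ⟩
        concat Sp.blocks ++ Sp.rest ≡⟨ Sp.split ⟩
        rest ∎
    sizes : All (λ g → length g ≡ 2 * k) (b ∷ Bs)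
    sizes = subst (All _) (sym eq) Sp.size
    long : All (λ g → suc (i₀ + i₀) < length g) glues
    long = ≤-trans (≤-reflexive (trans (sym m≡) (sym (All.head sizes)))) (≤-trans (m≤m+n _ _) (≤-reflexive (sym (length-++ b))))
           ∷ All.map (λ e → ≤-reflexive (trans (sym m≡) (sym e))) (All.tail sizes)
    go′ : (F : CreatingFamily n (2 * k)) → length (CreatingFamily.paths F) * (d ^ c) ^ T ≤ n ^ n * ((3 ^ n) ^ T * (n * n) ^ (7 * c))
    go′ = subst (λ M → (F : CreatingFamily n M) → length (CreatingFamily.paths F) * (d ^ c) ^ T ≤ n ^ n * ((3 ^ n) ^ T * (n * n) ^ (7 * c)))
      (sym m≡)
      (Counting.bound d c i₀ V glues T partition V-size 0<c (trans (cong length eq) Sp.number)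
        (s≤s (≤-trans 1≤i₀ (m≤m+n i₀ i₀))) long (subst (λ z → (T * (3 * d)) ^ z ≤ c) (cong (_∸ 1) m≡) ball))

-- Estimates

^-cancelˡ-≤ : ∀ M {x y} → x ^ suc M ≤ y ^ suc M → x ≤ y
^-cancelˡ-≤ M le = ≮⇒≥ (λ y<x → <⇒≱ (^-monoˡ-< (suc M) y<x) le)

^-*-comm : ∀ x m n → (x ^ m) ^ n ≡ (x ^ n) ^ m
^-*-comm x m n = trans (^-*-assoc x m n) (trans (cong (x ^_) (*-comm m n)) (sym (^-*-assoc x n m)))

^-distribʳ-* : ∀ x y e → (x * y) ^ e ≡ x ^ e * y ^ e
^-distribʳ-* x y zero = refl
^-distribʳ-* x y (suc e) = trans (cong (x * y *_) (^-distribʳ-* x y e)) (arith x y (x ^ e) (y ^ e))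
  where
  arith : ∀ x y u v → x * y * (u * v) ≡ x * u * (y * v)
  arith = solve-∀

m<[1+m/n]*n : ∀ m n .{{_ : NonZero n}} → m < suc (m / n) * n
m<[1+m/n]*n m n = subst (_< suc (m / n) * n) (sym (m≡m%n+[m/n]*n m n)) (+-monoˡ-< (m / n * n) (m%n<n m n))

-- The `r` largest factors of the factorial all exceed `s`.
power≤factorial : ∀ s r → s ^ r ≤ (s + r) !
power≤factorial s zero = 1≤n! (s + 0)
power≤factorial s (suc r) = ≤-trans (*-mono-≤ (m≤n⇒m≤1+n (m≤m+n s r)) (power≤factorial s r)) (≤-reflexive (cong _! (sym (+-suc s r))))

-- With M = 3b and C = 2kM, the first summand forces `C ^ M ≤ s`, which absorbs the constant in
-- `n ≤ C * s` into one extra power of `s`. The second pays for rounding `n / k`.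
lower-threshold : ℕ → ℕ → ℕ
lower-threshold k b = suc (k * (3 * b) * (2 * k * (3 * b)) ^ (3 * b)) + 3 * b * b * k

-- With s = q/3b one has q! ≥ s^(q-s) and n = O(s); the (3b)-th powers of both sides are compared.
lower-estimate : ∀ j a b n (let k = suc (suc j)) → 0 < a → 0 < b → lower-threshold k b ≤ n →
  n ^ ((b ∸ a * k) * n) ≤ ((pred n / k) !) ^ (k * b)
lower-estimate j a b@(suc b′) n 0<a 0<b N≤n with a * suc (suc j) ≤? b
... | no ak≰b = subst (λ z → n ^ (z * n) ≤ (q !) ^ (k * b)) (sym (m≤n⇒m∸n≡0 (<⇒≤ (≰⇒> ak≰b)))) (m^n>0 (q !) {{>-nonZero (1≤n! q)}} (k * b))
  where
  k = suc (suc j)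
  q = pred n / k
... | yes ak≤b = ≤-trans (^-cancelˡ-≤ (pred M) powers) (^-monoˡ-≤ (k * b) (subst (λ z → s ^ r ≤ z !) s+r (power≤factorial s r)))
  where
  k = suc (suc j)
  q = pred n / k
  M = 3 * b
  s = q / M
  r = q ∸ s
  e = b ∸ a * k
  C = 2 * k * M
  Ms≤q : s * M ≤ q
  Ms≤q = m/n*n≤m q M
  s+r : s + r ≡ q
  s+r = m+[n∸m]≡n (≤-trans (m≤m*n s M) Ms≤q)
  0<n : 0 < n
  0<n = ≤-trans (s≤s z≤n) N≤n
  n≡ : n ≡ suc (pred n)
  n≡ = sym (suc-pred n {{>-nonZero 0<n}})
  n≤ : n ≤ suc q * k
  n≤ = subst (_≤ suc q * k) (sym n≡) (m<[1+m/n]*n (pred n) k)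
  kq≤n : q * k ≤ n
  kq≤n = ≤-trans (m/n*n≤m (pred n) k) pred[n]≤n
  n≤s : n ≤ suc s * M * k
  n≤s = ≤-trans n≤ (*-monoˡ-≤ k (m<[1+m/n]*n q M))
  C^M≤s : C ^ M ≤ s
  C^M≤s = ≮⇒≥ (λ s< → <⇒≱ (≤-trans (m≤m+n _ (3 * b * b * k)) N≤n)
    (≤-trans n≤s (≤-trans (*-monoˡ-≤ k (*-monoˡ-≤ M s<)) (≤-reflexive (arith (C ^ M) M k)))))
    where
    arith : ∀ x M k → x * M * k ≡ k * M * x
    arith = solve-∀
  1≤s : 1 ≤ s
  1≤s = ≤-trans (m^n>0 C M) C^M≤s
  n≤Cs : n ≤ C * s
  n≤Cs = ≤-trans n≤s (≤-trans (*-monoˡ-≤ k (*-monoˡ-≤ M (+-monoˡ-≤ s 1≤s))) (≤-reflexive (arith s M k)))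
    where
    arith : ∀ s M k → (s + s) * M * k ≡ 2 * k * M * s
    arith = solve-∀
  -- Three losses, each at most `b * n`, arise from absorbing `C`, from giving up `s` factors of the
  -- factorial and from rounding. Since `M = 3 * b`, they are covered by `M * (a * k * n)`.
  exponents : suc M * (e * n) ≤ M * (k * b * r)
  exponents = +-cancelʳ-≤ (b * n + M * b * k) _ _ (≤-trans left right)
    where
    b≡ : e + a * k ≡ b
    b≡ = m∸n+n≡m ak≤b
    left : suc M * (e * n) + (b * n + M * b * k) ≤ M * (b * n)
    left = begin
      suc M * (e * n) + (b * n + M * b * k) ≤⟨ +-monoʳ-≤ (suc M * (e * n)) (+-monoʳ-≤ (b * n) (≤-trans (m≤n+m (M * b * k) (suc (k * M * C ^ M))) N≤n)) ⟩
      suc M * (e * n) + (b * n + n) ≡⟨ arith₁ M (e * n) (b * n) n ⟩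
      M * (e * n) + (e * n + b * n + n) ≤⟨ +-monoʳ-≤ (M * (e * n)) (+-mono-≤ (+-monoˡ-≤ (b * n) (*-monoˡ-≤ n (m∸n≤m b (a * k)))) (m≤n*m n b)) ⟩
      M * (e * n) + (b * n + b * n + b * n) ≡⟨ arith₂ b e n ⟩
      M * (e * n) + M * (1 * n) ≤⟨ +-monoʳ-≤ (M * (e * n)) (*-monoʳ-≤ M (*-monoˡ-≤ n (≤-trans 0<a (m≤m*n a k)))) ⟩
      M * (e * n) + M * (a * k * n) ≡⟨ arith₃ M e (a * k) n ⟩
      M * ((e + a * k) * n) ≡⟨ cong (λ z → M * (z * n)) b≡ ⟩
      M * (b * n) ∎
      where
      open ≤-Reasoning
      arith₁ : ∀ M x y n → suc M * x + (y + n) ≡ M * x + (x + y + n)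
      arith₁ = solve-∀
      arith₂ : ∀ b e n → 3 * b * (e * n) + (b * n + b * n + b * n) ≡ 3 * b * (e * n) + 3 * b * (1 * n)
      arith₂ = solve-∀
      arith₃ : ∀ M e f n → M * (e * n) + M * (f * n) ≡ M * ((e + f) * n)
      arith₃ = solve-∀
    right : M * (b * n) ≤ M * (k * b * r) + (b * n + M * b * k)
    right = begin
      M * (b * n) ≤⟨ *-monoʳ-≤ M (*-monoʳ-≤ b n≤) ⟩
      M * (b * (suc q * k)) ≡⟨ cong (λ z → M * (b * (suc z * k))) (sym s+r) ⟩
      M * (b * (suc (s + r) * k)) ≡⟨ arith M b s r k ⟩
      M * (k * b * r) + (b * (s * M * k) + M * b * k) ≤⟨ +-monoʳ-≤ (M * (k * b * r)) (+-monoˡ-≤ (M * b * k) (*-monoʳ-≤ b (≤-trans (*-monoˡ-≤ k Ms≤q) kq≤n))) ⟩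
      M * (k * b * r) + (b * n + M * b * k) ∎
      where
      open ≤-Reasoning
      arith : ∀ M b s r k → M * (b * (suc (s + r) * k)) ≡ M * (k * b * r) + (b * (s * M * k) + M * b * k)
      arith = solve-∀
  powers : (n ^ (e * n)) ^ M ≤ ((s ^ r) ^ (k * b)) ^ M
  powers = begin
    (n ^ (e * n)) ^ M ≡⟨ ^-*-comm n (e * n) M ⟩
    (n ^ M) ^ (e * n) ≤⟨ ^-monoˡ-≤ (e * n) (^-monoˡ-≤ M n≤Cs) ⟩
    ((C * s) ^ M) ^ (e * n) ≡⟨ cong (_^ (e * n)) (^-distribʳ-* C s M) ⟩
    (C ^ M * s ^ M) ^ (e * n) ≤⟨ ^-monoˡ-≤ (e * n) (*-monoˡ-≤ (s ^ M) C^M≤s) ⟩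
    (s ^ suc M) ^ (e * n) ≡⟨ ^-*-assoc s (suc M) (e * n) ⟩
    s ^ (suc M * (e * n)) ≤⟨ ^-monoʳ-≤ s {{>-nonZero 1≤s}} exponents ⟩
    s ^ (M * (k * b * r)) ≡⟨ cong (s ^_) (trans (*-comm M (k * b * r)) (cong (_* M) (*-comm (k * b) r))) ⟩
    s ^ (r * (k * b) * M) ≡⟨ ^-*-assoc s (r * (k * b)) M ⟨
    (s ^ (r * (k * b))) ^ M ≡⟨ cong (_^ M) (^-*-assoc s r (k * b)) ⟨
    ((s ^ r) ^ (k * b)) ^ M ∎
    where open ≤-Reasoning

-- A root up to a factor 2 is enough: along the induction on `n`, `d` is doubled whenever `n`
-- outgrows `d ^ e`.
approximate-root : ∀ e n → 0 < e → 0 < n → ∃ λ d → n ≤ d ^ e × d ^ e ≤ 2 ^ e * n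
approximate-root e (suc zero) _ _ = 1 , ≤-reflexive (sym (^-zeroˡ e)) ,
  ≤-trans (≤-reflexive (^-zeroˡ e)) (≤-trans (m^n>0 2 e) (≤-reflexive (sym (*-identityʳ (2 ^ e)))))
approximate-root e (suc (suc n)) 0<e _ with approximate-root e (suc n) 0<e (s≤s z≤n)
... | d , lo , hi with suc (suc n) ≤? d ^ e
...   | yes le = d , le , ≤-trans hi (*-monoʳ-≤ (2 ^ e) (n≤1+n (suc n)))
...   | no ¬le = 2 * d , ≤-trans big (≤-reflexive (sym (^-distribʳ-* 2 d e))) ,
        ≤-trans (≤-reflexive (^-distribʳ-* 2 d e)) (*-monoʳ-≤ (2 ^ e) (<⇒≤ (≰⇒> ¬le)))
  where
  big : suc (suc n) ≤ 2 ^ e * d ^ e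
  big = ≤-trans (s≤s (s≤s (m≤m+n n _))) (≤-trans (≤-reflexive (arith n)) (*-mono-≤ (^-monoʳ-≤ 2 0<e) lo))
    where
    arith : ∀ n → suc (suc (n + n)) ≡ 2 ^ 1 * suc n
    arith = solve-∀

-- T is the number of layers and Q the number of vertices needed per edge chosen in a layer; K comes from
-- cubing the bound on the number of walks.
T-of Q-of K-of upper-threshold : ℕ → ℕ → ℕ
T-of k b = b * (7 + 56 * k)
Q-of k b = T-of k b + 7 + 14 * k
K-of k b = (T-of k b * 3) ^ (6 * k) * (2 ^ (3 * k)) ^ 2
upper-threshold k b = suc (Q-of k b + 8 * Q-of k b ^ 3 * K-of k b + 3 ^ (T-of k b * (3 * k * b)) + b * Q-of k b)

module Upper (k′ b′ n : ℕ) (N≤n : upper-threshold (suc k′) (suc b′) ≤ n) where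

  k = suc k′
  b = suc b′
  T = T-of k b
  Q = Q-of k b
  K = K-of k b

  instance
    Q≢0 : NonZero Q
    Q≢0 = _

  c : ℕ
  c = n / Q

  0<n : 0 < n
  0<n = ≤-trans (s≤s z≤n) N≤n

  Qc≤n : c * Q ≤ n
  Qc≤n = m/n*n≤m n Q

  n<Qc+Q : n < suc c * Q
  n<Qc+Q = m<[1+m/n]*n n Q

  -- The four summands of the threshold serve, in turn, the positivity of `c`, the bound on walks,
  -- the cost of the labels and the rounding of `n / Q`.
  part₁ : Q ≤ n
  part₁ = ≤-trans (≤-trans (m≤m+n Q _) (≤-trans (m≤m+n _ (3 ^ (T * (3 * k * b)))) (≤-trans (m≤m+n _ (b * Q)) (n≤1+n _)))) N≤n

  part₂ : 8 * Q ^ 3 * K ≤ n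
  part₂ = ≤-trans (≤-trans (m≤n+m _ Q) (≤-trans (m≤m+n _ (3 ^ (T * (3 * k * b)))) (≤-trans (m≤m+n _ (b * Q)) (n≤1+n _)))) N≤n

  part₃ : 3 ^ (T * (3 * k * b)) ≤ n
  part₃ = ≤-trans (≤-trans (m≤n+m _ (Q + 8 * Q ^ 3 * K)) (≤-trans (m≤m+n _ (b * Q)) (n≤1+n _))) N≤n

  part₄ : b * Q ≤ n
  part₄ = ≤-trans (≤-trans (m≤n+m _ (Q + 8 * Q ^ 3 * K + 3 ^ (T * (3 * k * b)))) (n≤1+n _)) N≤n

  0<c : 0 < c
  0<c = ≰⇒> (λ c≤0 → <⇒≱ n<Qc+Q (≤-trans (*-monoˡ-≤ Q (s≤s c≤0)) (≤-trans (≤-reflexive (*-identityˡ Q)) part₁)))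

  fits : T * c + 7 * c + 7 * c * (2 * k) ≤ n
  fits = ≤-trans (≤-reflexive (arith T c k)) Qc≤n
    where
    arith : ∀ T c k → T * c + 7 * c + 7 * c * (2 * k) ≡ c * (T + 7 + 14 * k)
    arith = solve-∀

  root = approximate-root (3 * k) n (s≤s z≤n) 0<n
  d : ℕ
  d = proj₁ root

  n≤d^3k : n ≤ d ^ (3 * k)
  n≤d^3k = proj₁ (proj₂ root)

  0<d : 0 < d
  0<d = ≰⇒> (λ d≤0 → <⇒≱ 0<n (≤-trans n≤d^3k (^-monoˡ-≤ (3 * k) d≤0)))

  -- d^(2k) is of order n^(2/3), well below c.
  ball : (T * (3 * d)) ^ (2 * k ∸ 1) ≤ c
  ball = ≤-trans (^-monoʳ-≤ X {{>-nonZero 0<X}} (m∸n≤m (2 * k) 1)) (^-cancelˡ-≤ 2 cubes)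
    where
    X = T * (3 * d)
    0<X : 0 < X
    0<X = *-mono-< {0} {T} {0} {3 * d} (s≤s z≤n) (≤-trans 0<d (m≤m+n d _))
    cube : (X ^ (2 * k)) ^ 3 ≤ K * n ^ 2
    cube = begin
      (X ^ (2 * k)) ^ 3 ≡⟨ ^-*-assoc X (2 * k) 3 ⟩
      X ^ (2 * k * 3) ≡⟨ cong₂ _^_ (sym (*-assoc T 3 d)) (arith₁ k) ⟩
      (T * 3 * d) ^ (6 * k) ≡⟨ ^-distribʳ-* (T * 3) d (6 * k) ⟩
      (T * 3) ^ (6 * k) * d ^ (6 * k) ≡⟨ cong ((T * 3) ^ (6 * k) *_) (trans (cong (d ^_) (arith₂ k)) (sym (^-*-assoc d (3 * k) 2))) ⟩
      (T * 3) ^ (6 * k) * (d ^ (3 * k)) ^ 2 ≤⟨ *-monoʳ-≤ ((T * 3) ^ (6 * k)) (^-monoˡ-≤ 2 (proj₂ (proj₂ root))) ⟩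
      (T * 3) ^ (6 * k) * (2 ^ (3 * k) * n) ^ 2 ≡⟨ cong ((T * 3) ^ (6 * k) *_) (^-distribʳ-* (2 ^ (3 * k)) n 2) ⟩
      (T * 3) ^ (6 * k) * ((2 ^ (3 * k)) ^ 2 * n ^ 2) ≡⟨ *-assoc ((T * 3) ^ (6 * k)) ((2 ^ (3 * k)) ^ 2) (n ^ 2) ⟨
      K * n ^ 2 ∎
      where
      open ≤-Reasoning
      arith₁ : ∀ k → 2 * k * 3 ≡ 6 * k
      arith₁ = solve-∀
      arith₂ : ∀ k → 6 * k ≡ 3 * k * 2
      arith₂ = solve-∀
    n≤2Qc : n ≤ 2 * Q * c
    n≤2Qc = ≤-trans (<⇒≤ n<Qc+Q) (≤-trans (*-monoˡ-≤ Q (+-monoˡ-≤ c 0<c)) (≤-reflexive (arith c Q)))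
      where
      arith : ∀ c Q → (c + c) * Q ≡ 2 * Q * c
      arith = solve-∀
    cubes : (X ^ (2 * k)) ^ 3 ≤ c ^ 3
    cubes = *-cancelˡ-≤ (8 * Q ^ 3) {{m*n≢0 8 (Q ^ 3) {{_}} {{m^n≢0 Q 3}}}} (begin
      8 * Q ^ 3 * (X ^ (2 * k)) ^ 3 ≤⟨ *-monoʳ-≤ (8 * Q ^ 3) cube ⟩
      8 * Q ^ 3 * (K * n ^ 2) ≡⟨ *-assoc (8 * Q ^ 3) K (n ^ 2) ⟨
      8 * Q ^ 3 * K * n ^ 2 ≤⟨ *-monoˡ-≤ (n ^ 2) part₂ ⟩
      n ^ 3 ≤⟨ ^-monoˡ-≤ 3 n≤2Qc ⟩
      (2 * Q * c) ^ 3 ≡⟨ ^-distribʳ-* (2 * Q) c 3 ⟩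
      (2 * Q) ^ 3 * c ^ 3 ≡⟨ cong (_* c ^ 3) (^-distribʳ-* 2 Q 3) ⟩
      8 * Q ^ 3 * c ^ 3 ∎)
      where open ≤-Reasoning

  -- The losses proportional to `b * c` are 7 for the unjoined pieces, `14 * k` for the chains and
  -- `42 * k` for the recorded ends. `T` is `b` times their sum, so together they cost `c * T ≤ n`.
  -- With `b * Q ≤ n` for rounding and `n` for the labels, the total `3 * n` fits into
  -- `3 * k * a * n`.
  exponents : ∀ a → 0 < a → n * (3 * k * b) + n + (2 * (7 * c)) * (3 * k * b) ≤ ((3 * k ∸ 1) * b + 3 * k * a) * n + c * T * b
  exponents a 0<a = subst (λ z → n * (z * b) + n + (2 * (7 * c)) * (3 * k * b) ≤ ((3 * k ∸ 1) * b + 3 * k * a) * n + c * T * b)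
    (m+[n∸m]≡n {1} {3 * k} (s≤s z≤n)) (main (3 * k ∸ 1))
    where
    open ≤-Reasoning
    main : ∀ z → n * ((1 + z) * b) + n + (2 * (7 * c)) * (3 * k * b) ≤ (z * b + 3 * k * a) * n + c * T * b
    main z = begin
      n * ((1 + z) * b) + n + (2 * (7 * c)) * (3 * k * b) ≡⟨ arith₁ n z b c k ⟩
      z * b * n + (b * n + n + 42 * k * b * c)
        ≤⟨ +-monoʳ-≤ (z * b * n) (+-monoˡ-≤ (42 * k * b * c) (+-monoˡ-≤ n (*-monoʳ-≤ b (<⇒≤ n<Qc+Q)))) ⟩
      z * b * n + (b * (suc c * Q) + n + 42 * k * b * c) ≡⟨ arith₂ (z * b * n) b c k n T ⟩
      z * b * n + (b * Q + c * (b * (7 + 56 * k)) + n) + c * T * b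
        ≤⟨ +-monoˡ-≤ (c * T * b) (+-monoʳ-≤ (z * b * n) (+-monoˡ-≤ n (+-mono-≤ part₄ (≤-trans (*-monoʳ-≤ c (≤-trans (m≤m+n T 7) (m≤m+n (T + 7) (14 * k)))) Qc≤n)))) ⟩
      z * b * n + (n + n + n) + c * T * b ≡⟨ arith₃ (z * b * n) n (c * T * b) ⟩
      z * b * n + 3 * 1 * 1 * n + c * T * b
        ≤⟨ +-monoˡ-≤ (c * T * b) (+-monoʳ-≤ (z * b * n) (*-monoˡ-≤ n (*-mono-≤ (*-monoʳ-≤ 3 (s≤s (z≤n {k′}))) 0<a))) ⟩
      z * b * n + 3 * k * a * n + c * T * b ≡⟨ cong (_+ c * T * b) (sym (*-distribʳ-+ n (z * b) (3 * k * a))) ⟩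
      (z * b + 3 * k * a) * n + c * T * b ∎
      where
      arith₁ : ∀ n z b c k → n * ((1 + z) * b) + n + (2 * (7 * c)) * (3 * k * b) ≡ z * b * n + (b * n + n + 42 * k * b * c)
      arith₁ = solve-∀
      arith₂ : ∀ y b c k n T → y + (b * (suc c * (T + 7 + 14 * k)) + n + 42 * k * b * c) ≡ y + (b * (T + 7 + 14 * k) + c * (b * (7 + 56 * k)) + n) + c * T * b
      arith₂ = solve-∀
      arith₃ : ∀ y n w → y + (n + n + n) + w ≡ y + 3 * 1 * 1 * n + w
      arith₃ = solve-∀

  -- In the power `3 * k * b` the choices are worth at least `n ^ (c * T * b)`, because
  -- `n ≤ d ^ (3 * k)`, and the labels cost at most `n ^ n`.
  estimate : ∀ a h → 0 < a → h * (d ^ c) ^ T ≤ n ^ n * ((3 ^ n) ^ T * (n * n) ^ (7 * c)) →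
    h ^ (3 * k * b) ≤ n ^ (((3 * k ∸ 1) * b + 3 * k * a) * n)
  estimate a h 0<a le = *-cancelʳ-≤ _ _ (n ^ (c * T * b)) {{m^n≢0 n (c * T * b) {{>-nonZero 0<n}}}} (begin
    h ^ x * n ^ (c * T * b) ≤⟨ *-monoʳ-≤ (h ^ x) choices ⟩
    h ^ x * ((d ^ c) ^ T) ^ x ≡⟨ ^-distribʳ-* h ((d ^ c) ^ T) x ⟨
    (h * (d ^ c) ^ T) ^ x ≤⟨ ^-monoˡ-≤ x le ⟩
    (n ^ n * ((3 ^ n) ^ T * (n * n) ^ (7 * c))) ^ x ≡⟨ trans (^-distribʳ-* (n ^ n) _ x) (cong ((n ^ n) ^ x *_) (^-distribʳ-* ((3 ^ n) ^ T) _ x)) ⟩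
    (n ^ n) ^ x * (((3 ^ n) ^ T) ^ x * ((n * n) ^ (7 * c)) ^ x)
      ≤⟨ *-mono-≤ (≤-reflexive (^-*-assoc n n x)) (*-mono-≤ labels (≤-reflexive glue)) ⟩
    n ^ (n * x) * (n ^ n * n ^ (2 * (7 * c) * x)) ≡⟨ *-assoc (n ^ (n * x)) (n ^ n) _ ⟨
    n ^ (n * x) * n ^ n * n ^ (2 * (7 * c) * x) ≡⟨ cong (_* n ^ (2 * (7 * c) * x)) (^-distribˡ-+-* n (n * x) n) ⟨
    n ^ (n * x + n) * n ^ (2 * (7 * c) * x) ≡⟨ ^-distribˡ-+-* n (n * x + n) (2 * (7 * c) * x) ⟨
    n ^ (n * x + n + 2 * (7 * c) * x) ≤⟨ ^-monoʳ-≤ n {{>-nonZero 0<n}} (exponents a 0<a) ⟩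
    n ^ (((3 * k ∸ 1) * b + 3 * k * a) * n + c * T * b) ≡⟨ ^-distribˡ-+-* n (((3 * k ∸ 1) * b + 3 * k * a) * n) (c * T * b) ⟩
    n ^ (((3 * k ∸ 1) * b + 3 * k * a) * n) * n ^ (c * T * b) ∎)
    where
    open ≤-Reasoning
    x = 3 * k * b
    choices : n ^ (c * T * b) ≤ ((d ^ c) ^ T) ^ x
    choices = ≤-trans (^-monoˡ-≤ (c * T * b) n≤d^3k) (≤-reflexive (trans (^-*-assoc d (3 * k) (c * T * b))
      (trans (cong (d ^_) (arith c T b k)) (sym (trans (cong (_^ x) (^-*-assoc d c T)) (^-*-assoc d (c * T) x))))))
      where
      arith : ∀ c T b k → 3 * k * (c * T * b) ≡ c * T * (3 * k * b)
      arith = solve-∀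
    labels : ((3 ^ n) ^ T) ^ x ≤ n ^ n
    labels = ≤-trans (≤-reflexive (trans (^-*-assoc (3 ^ n) T x) (^-*-comm 3 n (T * x)))) (^-monoˡ-≤ n part₃)
    glue : ((n * n) ^ (7 * c)) ^ x ≡ n ^ (2 * (7 * c) * x)
    glue = trans (cong (_^ x) (trans (cong (_^ (7 * c)) (cong (n *_) (sym (*-identityʳ n)))) (^-*-assoc n 2 (7 * c)))) (^-*-assoc n (2 * (7 * c)) x)

-- The term o(n) is read as εn for each rational ε = a/b > 0 and all large `n`. Taking powers
-- `k * b` and `3 * k * b` clears the denominators of the exponents 1/k - ε and 1 - 1/(3k) + ε. For
-- ε ≥ 1/k the truncated subtraction gives exponent 0.
theorem1p7 : (k : ℕ) → 2 < k → (a b : ℕ) → 0 < a → 0 < b →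
    ∃ λ N → (n : ℕ) → N ≤ n → (h : ℕ) → IsH n (2 * k) h →
    (n ^ ((b ∸ a * k) * n) ≤ h ^ (k * b)) ×
    (h ^ (3 * k * b) ≤ n ^ (((3 * k ∸ 1) * b + 3 * k * a) * n))
theorem1p7 k@(suc (suc j)) (s≤s (s≤s 1≤j)) a b@(suc b′) 0<a 0<b = lower-threshold k b + upper-threshold k b , bounds
  where
  bounds : ∀ n → lower-threshold k b + upper-threshold k b ≤ n → ∀ h → IsH n (2 * k) h →
    (n ^ ((b ∸ a * k) * n) ≤ h ^ (k * b)) × (h ^ (3 * k * b) ≤ n ^ (((3 * k ∸ 1) * b + 3 * k * a) * n))
  bounds n N≤n h ((F , refl) , maximal) = lower , upper
    where
    low : lower-threshold k b ≤ n
    low = m+n≤o⇒m≤o (lower-threshold k b) N≤n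
    q : ℕ
    -- The predecessor reserves the vertex that closes the last cell.
    q = pred n / k
    room : suc (q * k) ≤ n
    room = subst (suc (q * k) ≤_) (suc-pred n {{>-nonZero (≤-trans (s≤s z≤n) low)}}) (s≤s (m/n*n≤m (pred n) k))
    family : Σ (CreatingFamily n (2 * k)) λ F′ → length (CreatingFamily.paths F′) ≡ q !
    family = blocks-family n j q 1≤j room
    lower : n ^ ((b ∸ a * k) * n) ≤ h ^ (k * b)
    lower = ≤-trans (lower-estimate j a b n 0<a 0<b low)
      (^-monoˡ-≤ (k * b) (subst (_≤ h) (proj₂ family) (maximal (proj₁ family))))
    open Upper (suc j) b′ n (m+n≤o⇒n≤o (lower-threshold k b) N≤n) using (d; c; T; 0<c; fits; ball; estimate)
    upper : h ^ (3 * k * b) ≤ n ^ (((3 * k ∸ 1) * b + 3 * k * a) * n)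
    upper = estimate a h 0<a (creating-family-bound n k d c T (s≤s (s≤s z≤n)) 0<c fits ball F)
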